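{- 1. Every I$_{\vdots}$-point and every II$_{\vdots}$-point of $\mathrm{PG}(8,q)$ is contained in a unique hwise-fixed-5-space. 2. Every fixed-I-line and every fixed-II-line is contained in a unique hwise-fixed-5-space.
   Context: Let $q>2$ be a prime power. Let $\phi$ be a collineation of $\mathrm{PG}(2,q^3)$ of order 3 fixing pointwise an $\mathbb F_q$-subplane $\mathcal P_{2,q}$. A point $\bar P$ of $\mathrm{PG}(2,q^3)$ has Type I if in $\mathcal P_{2,q}$, Type II if $\bar P,\bar P^\phi,\bar P^{\phi^2}$ are distinct and collinear, Type III otherwise. Bose representation: identifying $\mathbb F_{q^3}^3$ with $\mathbb F_q^9$, each point $\bar P$ corresponds to a plane $[\![P]\!]$ of $\mathrm{PG}(8,q)$; a point of $\mathrm{PG}(8,q)$ is an X-point if it lies in $[\![P]\!]$ with $\bar P$ of Type X. $\phi$ induces a projectivity $\sigma$ of $\mathrm{PG}(8,q)$ of order 3 with $[\![P]\!]^\sigma=[\![P^\phi]\!]$. A I-point $A$ is a I$_{\vdots}$-point if $A,A^\sigma,A^{\sigma^2}$ are distinct and collinear; a II-point $B$ is a II$_{\vdots}$-point if $B,B^\sigma,B^{\sigma^2}$ are collinear. A fixed-I-line (fixed-II-line) is a $\sigma$-fixed line containing a I$_{\vdots}$-point (II$_{\vdots}$-point). A hwise-fixed-5-space is a 5-space $\Pi$ such that every 6-space containing $\Pi$ is fixed by $\sigma$. -}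

module Defs where

open import Level using (0ℓ)
open import Algebra.Bundles using (CommutativeRing)
open import Data.Nat as ℕ using (ℕ; zero; suc)
open import Data.Nat.Primality using (Prime)
open import Data.Fin using (Fin)
open import Data.List using (List; []; _∷_)
open import Data.Product using (Σ; ∃; _×_; _,_)
open import Data.Unit using (⊤)
open import Relation.Nullary using (¬_)
open import Relation.Binary.PropositionalEquality using (_≡_)

IsPrimePower : ℕ → Set
IsPrimePower q = Σ ℕ λ p → Σ ℕ λ k → Prime p × q ≡ p ℕ.^ k

record IsField (R : CommutativeRing 0ℓ 0ℓ) : Set where
  open CommutativeRing R
  field
    0≉1 : ¬ (0# ≈ 1#)
    inverse : ∀ x → ¬ (x ≈ 0#) → ∃ λ y → x * y ≈ 1#

HasSize : CommutativeRing 0ℓ 0ℓ → ℕ → Set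
HasSize R n = Σ (Fin n → Carrier) λ f →
    (∀ i j → f i ≈ f j → i ≡ j) × (∀ x → ∃ λ i → f i ≈ x)
  where open CommutativeRing R

-- Geometry over K = Carrier R (playing F_{q^3}); F_q = {x | x^q = x}.
-- V = K^3; PG(2,q^3) = nonzero V modulo K^*, PG(8,q) = nonzero V modulo F_q^*.
module Geometry (R : CommutativeRing 0ℓ 0ℓ) (q : ℕ) where
  open CommutativeRing R public using (Carrier; _≈_; _+_; _*_; 0#; 1#)

  pow : Carrier → ℕ → Carrier
  pow x zero = 1#
  pow x (suc n) = x * pow x n

  InF : Carrier → Set
  InF x = pow x q ≈ x

  V : Set
  V = Carrier × Carrier × Carrier

  _≈v_ : V → V → Set
  (a , b , c) ≈v (a' , b' , c') = (a ≈ a') × (b ≈ b') × (c ≈ c')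

  0v : V
  0v = 0# , 0# , 0#

  _+v_ : V → V → V
  (a , b , c) +v (a' , b' , c') = (a + a') , (b + b') , (c + c')

  _·v_ : Carrier → V → V
  k ·v (a , b , c) = (k * a) , (k * b) , (k * c)

  NonZeroV : V → Set
  NonZeroV v = ¬ (v ≈v 0v)

  -- w lies in the K-span of v (for nonzero v,w: same point of PG(2,q^3))
  KProp : V → V → Set
  KProp v w = ∃ λ k → w ≈v (k ·v v)

  -- w is an F_q-multiple of v (for nonzero v,w: same point of PG(8,q))
  FProp : V → V → Set
  FProp v w = ∃ λ k → InF k × w ≈v (k ·v v)

  data FComb : List V → V → Set where
    nil  : ∀ {x} → x ≈v 0v → FComb [] x
    cons : ∀ {v vs x} a y → InF a → FComb vs y → x ≈v ((a ·v v) +v y) → FComb (v ∷ vs) x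

  data KComb : List V → V → Set where
    nil  : ∀ {x} → x ≈v 0v → KComb [] x
    cons : ∀ {v vs x} a y → KComb vs y → x ≈v ((a ·v v) +v y) → KComb (v ∷ vs) x

  FIndep : List V → Set
  FIndep [] = ⊤
  FIndep (v ∷ vs) = ¬ FComb vs v × FIndep vs

  KIndep : List V → Set
  KIndep [] = ⊤
  KIndep (v ∷ vs) = ¬ KComb vs v × KIndep vs

  -- subsets of V (subspaces of PG(8,q) are given by their vectors)
  Sub : Set₁
  Sub = V → Set

  _⊆_ : Sub → Sub → Set
  S ⊆ T = ∀ x → S x → T x

  _≐_ : Sub → Sub → Set
  S ≐ T = S ⊆ T × T ⊆ S

  length : List V → ℕ
  length [] = zero
  length (_ ∷ vs) = suc (length vs)

  IsSpace : ℕ → Sub → Set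
  IsSpace d S = Σ (List V) λ bs → length bs ≡ suc d × FIndep bs × (∀ x → (S x → FComb bs x) × (FComb bs x → S x))

  module WithMaps (σ : V → V) (e₁ e₂ e₃ : V) where

    σ² : V → V
    σ² x = σ (σ x)

    σ³ : V → V
    σ³ x = σ (σ (σ x))

    Fixed : Sub → Set
    Fixed S = (∀ x → S x → S (σ x)) × (∀ x → S x → ∃ λ y → S y × σ y ≈v x)

    InSubplane : V → Set
    InSubplane v = ∃ λ a → ∃ λ b → ∃ λ c → InF a × InF b × InF c ×
                     KProp ((a ·v e₁) +v ((b ·v e₂) +v (c ·v e₃))) v

    -- point types of PG(2,q^3) (v a nonzero representative; φ acts as v ↦ σ v)
    TypeI : V → Set
    TypeI v = InSubplane v

    TypeII : V → Set
    TypeII v = ¬ KProp v (σ v) × ¬ KProp v (σ² v) × ¬ KProp (σ v) (σ² v)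
               × ¬ KIndep (v ∷ σ v ∷ σ² v ∷ [])

    -- X-points of PG(8,q): w ∈ [[P]] iff ⟨w⟩_K = P
    IPoint : V → Set
    IPoint w = NonZeroV w × TypeI w

    IIPoint : V → Set
    IIPoint w = NonZeroV w × TypeII w

    CollinearF : V → Set
    CollinearF w = ¬ FIndep (w ∷ σ w ∷ σ² w ∷ [])

    IDotPoint : V → Set
    IDotPoint w = IPoint w × ¬ FProp w (σ w) × ¬ FProp w (σ² w) × ¬ FProp (σ w) (σ² w)
                  × CollinearF w

    IIDotPoint : V → Set
    IIDotPoint w = IIPoint w × CollinearF w

    FixedILine : Sub → Set
    FixedILine L = IsSpace 1 L × Fixed L × ∃ λ x → L x × IDotPoint x

    FixedIILine : Sub → Set
    FixedIILine L = IsSpace 1 L × Fixed L × ∃ λ x → L x × IIDotPoint x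

    HwiseFixed5Space : Sub → Set₁
    HwiseFixed5Space Π = IsSpace 5 Π × (∀ S → IsSpace 6 S → Π ⊆ S → Fixed S)

    UniqueHwise : Sub → Set₁
    UniqueHwise X = Σ Sub λ Π → (HwiseFixed5Space Π × X ⊆ Π) ×
                      (∀ Π' → HwiseFixed5Space Π' → X ⊆ Π' → Π' ≐ Π)

    PointSub : V → Sub
    PointSub w x = FProp w x

  -- Hypotheses: σ is an F_q-linear bijection of V of projective order 3,
  -- σ([[P]]) = [[P^φ]], φ : ⟨v⟩_K ↦ ⟨σ v⟩_K is a collineation of order 3
  -- fixing pointwise the F_q-subplane determined by the K-basis e₁,e₂,e₃.
  record Setting (σ : V → V) (e₁ e₂ e₃ : V) : Set where
    field
      σ-cong   : ∀ x y → x ≈v y → σ x ≈v σ y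
      σ-add    : ∀ x y → σ (x +v y) ≈v (σ x +v σ y)
      σ-Flin   : ∀ a x → InF a → σ (a ·v x) ≈v (a ·v σ x)
      σ-inj    : ∀ x y → σ x ≈v σ y → x ≈v y
      σ-surj   : ∀ y → ∃ λ x → σ x ≈v y
      σ³-id    : ∃ λ c → InF c × ¬ (c ≈ 0#) × (∀ x → σ (σ (σ x)) ≈v (c ·v x))
      σ-nonid  : ¬ (∃ λ c → InF c × (∀ x → σ x ≈v (c ·v x)))
      -- [[P]]^σ = [[P^φ]]
      σ-Kline  : ∀ k v → ∃ λ k' → σ (k ·v v) ≈v (k' ·v σ v)
      σ-Kline⁻ : ∀ k v → ∃ λ k' → (k ·v σ v) ≈v σ (k' ·v v)
      φ-coll   : ∀ u v w → NonZeroV u → NonZeroV v → NonZeroV w →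
                   (¬ KIndep (u ∷ v ∷ w ∷ []) → ¬ KIndep (σ u ∷ σ v ∷ σ w ∷ [])) ×
                   (¬ KIndep (σ u ∷ σ v ∷ σ w ∷ []) → ¬ KIndep (u ∷ v ∷ w ∷ []))
      φ³-id    : ∀ v → KProp v (σ (σ (σ v)))
      φ-nonid  : ∃ λ v → NonZeroV v × ¬ KProp v (σ v)
      basis    : KIndep (e₁ ∷ e₂ ∷ e₃ ∷ [])
      fixes    : ∀ a b c → InF a → InF b → InF c →
                   let w = (a ·v e₁) +v ((b ·v e₂) +v (c ·v e₃)) in KProp w (σ w)

{-# OPTIONS --safe #-}

-- Since φ fixes the subplane pointwise, σ (x e₁ + y e₂ + z e₃) = g x e₁ + g y e₂ + g z e₃, where g = μ f for an
-- automorphism f of K of order 3. Its fixed field has q elements because K is 3-dimensional over it, hence it is F_q,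
-- and σ is F_q-linear with σ³ = c.
-- If Π is hwise-fixed then σ acts on V/Π as a scalar ℓ with ℓ³ = c, so Π contains the image of σ − ℓ. That image is the
-- kernel of σ² + ℓ σ + ℓ²: on K this kernel has F_q-dimension 2, since the form W x y = x g y − y g x takes values there
-- that f scales by a common factor. Thus the hwise-fixed 5-spaces are exactly these kernels.
-- A I⋮- or II⋮-point w is not an eigenvector but w, σw, σ²w are dependent, which forces σ²w + ℓ σw + ℓ² w = 0 for some
-- ℓ with ℓ³ = c; two different ℓ would make w an eigenvector. A fixed line through w is spanned by w and σw.
module Submission where

open import Defs
open import Level using (0ℓ)
open import Algebra.Bundles using (CommutativeRing; RawRing)
import Algebra.Properties.AbelianGroup
import Algebra.Properties.CommutativeMonoid.Sum
import Algebra.Properties.CommutativeSemigroup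
import Algebra.Properties.Group
import Algebra.Properties.Ring
import Algebra.Properties.Semiring.Mult
import Algebra.Solver.Ring
open import Algebra.Solver.Ring.AlmostCommutativeRing
  using (fromCommutativeRing; _-Raw-AlmostCommutative⟶_; Induced-equivalence)
open import Data.Fin as Fin using (Fin; zero; suc; remQuot; combine; punchOut; punchIn)
open import Data.Fin.Permutation using (Permutation; permutation; _⟨$⟩ʳ_)
open import Data.Fin.Properties using (any?; injective⇒≤; punchOut-injective; punchInᵢ≢i;
  suc-injective; combine-remQuot; remQuot-combine; ¬∀⟶∃¬)
open import Data.List using (List; []; _∷_; map)
open import Data.List.Relation.Unary.All as All using (All; []; _∷_)
open import Data.Maybe using (just; nothing)
open import Data.Nat as ℕ using (ℕ; zero; suc; _<_; _^_)
import Data.Nat.Properties as ℕ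
open import Data.Product using (Σ; ∃; _×_; _,_; proj₁; proj₂)
open import Data.Product.Relation.Binary.Pointwise.NonDependent using (Pointwise; ×-setoid)
open import Data.Sum using ([_,_]′)
open import Data.Unit using (⊤; tt)
open import Function using (_∘_)
open import Relation.Binary.Bundles using (Setoid)
open import Relation.Binary.Definitions using (WeaklyDecidable; tri<; tri≈; tri>)
import Relation.Binary.Reasoning.Setoid as SetoidReasoning
open import Relation.Binary.Structures using (IsEquivalence)
open import Relation.Binary.PropositionalEquality as ≡ using (_≡_; cong)
open import Relation.Nullary using (¬_; Dec; yes; no; contradiction)
open import Relation.Nullary.Decidable as Dec using (decidable-stable; toSum)

-- This fixes the order of the argument: the automorphism f is extracted from σ first, and `InF`
-- becomes a subfield only through its identification with the fixed field of f. One inclusion comes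
-- from Fermat's little theorem on a set of q elements, the other from the F_q-linearity of σ.
-- Dimension theory is replaced by counting: a space with d + 1 independent generators has q^(d+1)
-- vectors, so an inclusion between spaces of the same dimension is an equality, and a 5- or 6-space
-- misses some of the q^9 vectors. Finiteness also makes membership decidable, which recovers
-- positive statements from the negated form of collinearity. Since σ has order 3 only projectively,
-- σ³ is a scalar c, and the cube roots ℓ of c in F_q take the place of the cube roots of unity.

abstract
  injective⇒hits : ∀ {n} (f : Fin n → Fin n) → (∀ {i j} → f i ≡ f j → i ≡ j) →
    ∀ j → ∃ λ i → f i ≡ j
  injective⇒hits {suc n} f f-inj j with any? (λ i → f i Fin.≟ j)
  ... | yes hit = hit
  ... | no miss = contradiction
    (injective⇒≤ {f = λ i → punchOut (miss′ i)} (f-inj ∘ punchOut-injective (miss′ _) (miss′ _)))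
    ℕ.1+n≰n
    where
    miss′ : ∀ i → ¬ (j ≡ f i)
    miss′ i j≡fi = miss (i , ≡.sym j≡fi)

  -- The size `m` stays existential: for the fixed field it is determined only afterwards, by
  -- comparing cardinalities.
  select : ∀ n (P : Fin n → Set) → (∀ i → Dec (P i)) → ∃ λ m → Σ (Fin m → Fin n) λ s →
    (∀ i j → s i ≡ s j → i ≡ j) × (∀ i → P (s i)) × (∀ j → P j → ∃ λ i → s i ≡ j)
  select zero P P? = 0 , (λ ()) , (λ ()) , (λ ()) , (λ ())
  select (suc n) P P? with P? zero | select n (P ∘ suc) (P? ∘ suc)
  ... | no ¬p | m , s , inj , sound , complete =
    m , suc ∘ s , (λ i j eq → inj i j (suc-injective eq)) , sound , complete′
    where
    complete′ : ∀ j → P j → ∃ λ i → suc (s i) ≡ j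
    complete′ zero p = contradiction p ¬p
    complete′ (suc j) p = proj₁ (complete j p) , cong suc (proj₂ (complete j p))
  ... | yes p | m , s , inj , sound , complete =
    suc m , s′ , inj′ , sound′ , complete′
    where
    s′ : Fin (suc m) → Fin (suc n)
    s′ zero = zero
    s′ (suc i) = suc (s i)
    inj′ : ∀ i j → s′ i ≡ s′ j → i ≡ j
    inj′ zero zero _ = ≡.refl
    inj′ (suc i) (suc j) eq = cong suc (inj i j (suc-injective eq))
    sound′ : ∀ i → P (s′ i)
    sound′ zero = p
    sound′ (suc i) = sound i
    complete′ : ∀ j → P j → ∃ λ i → s′ i ≡ j
    complete′ zero _ = zero , ≡.refl
    complete′ (suc j) p = suc (proj₁ (complete j p)) , cong suc (proj₂ (complete j p))

-- Cardinalities of subsets of a setoid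

record Enum {A : Set} (_~_ : A → A → Set) (P : A → Set) (N : ℕ) : Set where
  field
    to     : Fin N → A
    to-inj : ∀ i j → to i ~ to j → i ≡ j
    to-in  : ∀ i → P (to i)
    index  : ∀ x → P x → ∃ λ i → to i ~ x

open Enum

module Enumerations {A : Set} {_~_ : A → A → Set} (isEq : IsEquivalence _~_) where
  open IsEquivalence isEq

  private
    variable
      P Q : A → Set
      M N : ℕ

  abstract
    reindex : Enum _~_ P M → Enum _~_ Q N → (∀ x → P x → Q x) → Fin M → Fin N
    reindex E F P⊆Q i = proj₁ (index F (to E i) (P⊆Q _ (to-in E i)))

    reindex-~ : (E : Enum _~_ P M) (F : Enum _~_ Q N) (P⊆Q : ∀ x → P x → Q x) →
      ∀ i → to F (reindex E F P⊆Q i) ~ to E i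
    reindex-~ E F P⊆Q i = proj₂ (index F (to E i) (P⊆Q _ (to-in E i)))

    reindex-inj : (E : Enum _~_ P M) (F : Enum _~_ Q N) (P⊆Q : ∀ x → P x → Q x) →
      ∀ {i j} → reindex E F P⊆Q i ≡ reindex E F P⊆Q j → i ≡ j
    reindex-inj E F P⊆Q {i} {j} eq = to-inj E i j
      (trans (sym (reindex-~ E F P⊆Q i))
        (trans (reflexive (cong (to F) eq)) (reindex-~ E F P⊆Q j)))

    Enum-⊆⇒≤ : Enum _~_ P M → Enum _~_ Q N → (∀ x → P x → Q x) → M ℕ.≤ N
    Enum-⊆⇒≤ E F P⊆Q = injective⇒≤ {f = reindex E F P⊆Q} (reindex-inj E F P⊆Q)

    -- The inclusion induces an injection of Fin N into itself, which is onto. As P need not respect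
    -- `~`, only some element of P equivalent to x can be promised.
    Enum-⊆⇒⊇ : Enum _~_ P N → Enum _~_ Q N → (∀ x → P x → Q x) →
      ∀ x → Q x → ∃ λ y → P y × y ~ x
    Enum-⊆⇒⊇ E F P⊆Q x Qx with index F x Qx
    ... | j , to-j~x with injective⇒hits (reindex E F P⊆Q) (reindex-inj E F P⊆Q) j
    ... | i , eq = to E i , to-in E i ,
      trans (sym (reindex-~ E F P⊆Q i)) (trans (reflexive (cong (to F) eq)) to-j~x)

    Enum-cong : (∀ x → P x → Q x) → (∀ x → Q x → P x) → Enum _~_ P N → Enum _~_ Q N
    Enum-cong P⊆Q Q⊆P E = record
      { to = to E ; to-inj = to-inj E
      ; to-in = λ i → P⊆Q _ (to-in E i) ; index = λ x Qx → index E x (Q⊆P x Qx) }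

    Enum-filter : (∀ x → Dec (P x)) → (∀ {x y} → x ~ y → P x → P y) →
      Enum _~_ (λ _ → ⊤) N → ∃ λ M → Enum _~_ P M
    Enum-filter {P = P} {N = N} P? resp E with select N (P ∘ to E) (P? ∘ to E)
    ... | M , s , inj , sound , complete = M , record
      { to = to E ∘ s
      ; to-inj = λ i j eq → inj i j (to-inj E _ _ eq)
      ; to-in = sound
      ; index = λ x Px → let (j , eq) = index E x tt
                             (i , eq′) = complete j (resp (sym eq) Px)
                         in i , trans (reflexive (cong (to E) eq′)) eq }

    Enum-≟ : Enum _~_ (λ _ → ⊤) N → ∀ x y → Dec (x ~ y)
    Enum-≟ E x y with index E x tt | index E y tt
    ... | i , eqi | j , eqj = Dec.map′
      (λ i≡j → trans (sym eqi) (trans (reflexive (cong (to E) i≡j)) eqj))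
      (λ x~y → to-inj E i j (trans eqi (trans x~y (sym eqj))))
      (i Fin.≟ j)

    Enum-∃? : Enum _~_ P N → (∀ x → Dec (Q x)) → (∀ {x y} → x ~ y → Q x → Q y) →
      Dec (∃ λ x → P x × Q x)
    Enum-∃? E Q? resp = Dec.map′
      (λ (i , q) → to E i , to-in E i , q)
      (λ (x , p , q) → let (i , eq) = index E x p in i , resp (sym eq) q)
      (any? (Q? ∘ to E))

abstract
  Enum-× : ∀ {A B : Set} {_~_ : A → A → Set} {_~′_ : B → B → Set} {P : A → Set} {Q : B → Set} {M N} →
    Enum _~_ P M → Enum _~′_ Q N → Enum (Pointwise _~_ _~′_) (λ (x , y) → P x × Q y) (M ℕ.* N)
  Enum-× {_~_ = _~_} {_~′_} {M = M} {N = N} E F = record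
    { to = λ k → to E (proj₁ (remQuot N k)) , to F (proj₂ (remQuot {M} N k))
    ; to-inj = λ k l (eq₁ , eq₂) → ≡.trans (≡.sym (combine-remQuot {M} N k))
        (≡.trans (≡.cong₂ combine (to-inj E _ _ eq₁) (to-inj F _ _ eq₂)) (combine-remQuot {M} N l))
    ; to-in = λ k → to-in E _ , to-in F _
    ; index = λ (x , y) (Px , Qy) →
        let (i , eqi) = index E x Px
            (j , eqj) = index F y Qy
            rq = remQuot-combine {M} {N} i j
        in combine i j
         , ≡.subst (λ k → to E (proj₁ k) ~ x) (≡.sym rq) eqi
         , ≡.subst (λ k → to F (proj₂ k) ~′ y) (≡.sym rq) eqj }

module Images {A B : Set} {_~_ : A → A → Set} {_~′_ : B → B → Set} (isEq′ : IsEquivalence _~′_) where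
  open IsEquivalence isEq′

  abstract
    -- Injectivity is asked only on P: evaluation at θ₀ will be injective on triples from the fixed
    -- field, but not on all triples.
    Enum-image : ∀ {P N} (h : A → B) → (∀ {x y} → x ~ y → h x ~′ h y) →
      (∀ {x y} → P x → P y → h x ~′ h y → x ~ y) →
      Enum _~_ P N → Enum _~′_ (λ y → ∃ λ x → P x × h x ~′ y) N
    Enum-image h h-cong h-inj E = record
      { to = h ∘ to E
      ; to-inj = λ i j eq → to-inj E i j (h-inj (to-in E i) (to-in E j) eq)
      ; to-in = λ i → to E i , to-in E i , refl
      ; index = λ y (x , Px , eq) → let (i , eq′) = index E x Px in i , trans (h-cong eq′) eq }

-- A ring solver with integer coefficients

-- The standard ring solvers cancel x − x only if zero can be recognised among the coefficients by
-- computation. Differences a − b of naturals, as pairs (a , b), make this possible in any commutative ring.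
module RingSolver (R : CommutativeRing 0ℓ 0ℓ) where
  open CommutativeRing R hiding (zero)
  open Algebra.Properties.Ring ring using (x[y-z]≈xy-xz; [y-z]x≈yx-zx)
  open Algebra.Properties.AbelianGroup +-abelianGroup using (⁻¹-∙-comm; ⁻¹-anti-homo‿-; xyx⁻¹≈y; ε⁻¹≈ε)
  open Algebra.Properties.CommutativeSemigroup (CommutativeRing.+-commutativeSemigroup R) using (interchange)
  open Algebra.Properties.Semiring.Mult semiring using (×-homo-+; ×1-homo-*) renaming (_×_ to _·_)
  open SetoidReasoning setoid

  coefficients : RawRing 0ℓ 0ℓ
  coefficients = record
    { Carrier = ℕ × ℕ
    ; _≈_ = _≡_
    ; _+_ = λ (a , b) (c , d) → a ℕ.+ c , b ℕ.+ d
    ; _*_ = λ (a , b) (c , d) → a ℕ.* c ℕ.+ b ℕ.* d , a ℕ.* d ℕ.+ b ℕ.* c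
    ; -_ = λ (a , b) → b , a
    ; 0# = 0 , 0
    ; 1# = 1 , 0
    }

  private
    module C = RawRing coefficients

  difference : ℕ × ℕ → Carrier
  difference (a , b) = a · 1# - b · 1#

  -- The clauses for 0 and 1 make `:0` and `:1` denote `0#` and `1#` themselves, instead of
  -- differences that are merely equal to them, so that solved identities fit their goals literally.
  ⟦_⟧ : ℕ × ℕ → Carrier
  ⟦ 0 , 0 ⟧ = 0#
  ⟦ 1 , 0 ⟧ = 1#
  ⟦ p ⟧ = difference p

  ⟦⟧≈difference : ∀ p → ⟦ p ⟧ ≈ difference p
  ⟦⟧≈difference (0 , 0) = sym (-‿inverseʳ 0#)
  ⟦⟧≈difference (1 , 0) = sym (trans (+-cong (+-identityʳ 1#) ε⁻¹≈ε) (+-identityʳ 1#))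
  ⟦⟧≈difference (0 , suc b) = refl
  ⟦⟧≈difference (1 , suc b) = refl
  ⟦⟧≈difference (suc (suc a) , b) = refl

  -‿interchange : ∀ w x y z → (w - x) + (y - z) ≈ (w + y) - (x + z)
  -‿interchange w x y z = trans (interchange w (- x) y (- z)) (+-congˡ (⁻¹-∙-comm x z))

  difference-+ : ∀ p q → difference (p C.+ q) ≈ difference p + difference q
  difference-+ (a , b) (c , d) = begin
    (a ℕ.+ c) · 1# - (b ℕ.+ d) · 1#
      ≈⟨ +-cong (×-homo-+ 1# a c) (-‿cong (×-homo-+ 1# b d)) ⟩
    (a · 1# + c · 1#) - (b · 1# + d · 1#)
      ≈⟨ -‿interchange _ _ _ _ ⟨
    difference (a , b) + difference (c , d) ∎

  difference-* : ∀ p q → difference (p C.* q) ≈ difference p * difference q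
  difference-* (a , b) (c , d) = begin
    (a ℕ.* c ℕ.+ b ℕ.* d) · 1# - (a ℕ.* d ℕ.+ b ℕ.* c) · 1#
      ≈⟨ +-cong (×-homo a c b d) (-‿cong (×-homo a d b c)) ⟩
    (A * C + B * D) - (A * D + B * C)
      ≈⟨ -‿interchange _ _ _ _ ⟨
    (A * C - A * D) + (B * D - B * C)
      ≈⟨ +-congˡ (⁻¹-anti-homo‿- _ _) ⟨
    (A * C - A * D) - (B * C - B * D)
      ≈⟨ +-cong (x[y-z]≈xy-xz A C D) (-‿cong (x[y-z]≈xy-xz B C D)) ⟨
    A * (C - D) - B * (C - D)
      ≈⟨ [y-z]x≈yx-zx (C - D) A B ⟨
    (A - B) * (C - D) ∎
    where
    A B C D : Carrier
    A = a · 1#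
    B = b · 1#
    C = c · 1#
    D = d · 1#
    ×-homo : ∀ a c b d → (a ℕ.* c ℕ.+ b ℕ.* d) · 1# ≈ (a · 1#) * (c · 1#) + (b · 1#) * (d · 1#)
    ×-homo a c b d = trans (×-homo-+ 1# (a ℕ.* c) (b ℕ.* d)) (+-cong (×1-homo-* a c) (×1-homo-* b d))

  morphism : coefficients -Raw-AlmostCommutative⟶ fromCommutativeRing R
  morphism = record
    { ⟦_⟧ = ⟦_⟧
    ; +-homo = λ p q → trans (⟦⟧≈difference (p C.+ q)) (trans (difference-+ p q)
        (+-cong (sym (⟦⟧≈difference p)) (sym (⟦⟧≈difference q))))
    ; *-homo = λ p q → trans (⟦⟧≈difference (p C.* q)) (trans (difference-* p q)
        (*-cong (sym (⟦⟧≈difference p)) (sym (⟦⟧≈difference q))))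
    ; -‿homo = λ p → trans (⟦⟧≈difference (C.- p)) (trans (sym (⁻¹-anti-homo‿- _ _))
        (-‿cong (sym (⟦⟧≈difference p))))
    ; 0-homo = refl
    ; 1-homo = refl
    }

  difference-≈ : ∀ a b c d → a ℕ.+ d ≡ c ℕ.+ b → difference (a , b) ≈ difference (c , d)
  difference-≈ a b c d eq = begin
    a · 1# - b · 1#                      ≈⟨ xyx⁻¹≈y (d · 1#) _ ⟨
    (d · 1# + (a · 1# - b · 1#)) - d · 1# ≈⟨ +-congʳ (+-assoc _ _ _) ⟨
    ((d · 1# + a · 1#) - b · 1#) - d · 1# ≈⟨ +-congʳ (+-congʳ (+-comm _ _)) ⟩
    ((a · 1# + d · 1#) - b · 1#) - d · 1# ≈⟨ +-congʳ (+-congʳ (×-homo-+ 1# a d)) ⟨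
    ((a ℕ.+ d) · 1# - b · 1#) - d · 1#   ≈⟨ +-congʳ (+-congʳ (reflexive (cong (_· 1#) eq))) ⟩
    ((c ℕ.+ b) · 1# - b · 1#) - d · 1#   ≈⟨ +-congʳ (+-congʳ (×-homo-+ 1# c b)) ⟩
    ((c · 1# + b · 1#) - b · 1#) - d · 1# ≈⟨ +-congʳ (+-congʳ (+-comm _ _)) ⟩
    ((b · 1# + c · 1#) - b · 1#) - d · 1# ≈⟨ +-congʳ (xyx⁻¹≈y (b · 1#) _) ⟩
    c · 1# - d · 1# ∎

  -- Only a positive answer is conclusive, because distinct integers may agree in R, for instance
  -- modulo its characteristic.
  _coeff≟_ : WeaklyDecidable (Induced-equivalence morphism)
  (a , b) coeff≟ (c , d) with a ℕ.+ d ℕ.≟ c ℕ.+ b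
  ... | yes eq = just (trans (⟦⟧≈difference (a , b))
    (trans (difference-≈ a b c d eq) (sym (⟦⟧≈difference (c , d)))))
  ... | no _ = nothing

  open Algebra.Solver.Ring coefficients (fromCommutativeRing R) morphism _coeff≟_ public
    using (solve; _:=_; con; _:+_; _:*_; _:-_; :-_; Polynomial)

  :0 :1 : ∀ {n} → Polynomial n
  :0 = con (0 , 0)
  :1 = con (1 , 0)

-- Cancellation in a field

module FieldProperties (R : CommutativeRing 0ℓ 0ℓ) (isField : IsField R) where
  open CommutativeRing R hiding (zero)
  open IsField isField
  open SetoidReasoning setoid
  open RingSolver R
  open Algebra.Properties.Group +-group public using ()
    renaming (x∙y⁻¹≈ε⇒x≈y to x-y≈0⇒x≈y; x≈y⇒x∙y⁻¹≈ε to x≈y⇒x-y≈0)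

  *-cancel-≉0 : ∀ {x y z} → ¬ x ≈ 0# → x * y ≈ x * z → y ≈ z
  *-cancel-≉0 {x} {y} {z} x≉0 eq with inverse x x≉0
  ... | i , xi≈1 = begin
    y           ≈⟨ *-identityˡ y ⟨
    1# * y      ≈⟨ *-congʳ xi≈1 ⟨
    (x * i) * y ≈⟨ solve 3 (λ x i y → (x :* i) :* y := i :* (x :* y)) refl x i y ⟩
    i * (x * y) ≈⟨ *-congˡ eq ⟩
    i * (x * z) ≈⟨ solve 3 (λ x i y → (x :* i) :* y := i :* (x :* y)) refl x i z ⟨
    (x * i) * z ≈⟨ *-congʳ xi≈1 ⟩
    1# * z      ≈⟨ *-identityˡ z ⟩
    z           ∎

  xy≈0⇒y≈0 : ∀ {x y} → ¬ x ≈ 0# → x * y ≈ 0# → y ≈ 0#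
  xy≈0⇒y≈0 {x} x≉0 eq = *-cancel-≉0 x≉0 (trans eq (sym (zeroʳ x)))

  *-≉0 : ∀ {x y} → ¬ x ≈ 0# → ¬ y ≈ 0# → ¬ x * y ≈ 0#
  *-≉0 x≉0 y≉0 eq = y≉0 (xy≈0⇒y≈0 x≉0 eq)

  x-y≉0 : ∀ {x y} → ¬ x ≈ y → ¬ x - y ≈ 0#
  x-y≉0 x≉y eq = x≉y (x-y≈0⇒x≈y _ _ eq)

  -- Companion of the solver for conditional identities: the solver writes the goal as the wanted
  -- side plus a multiple of an expression known to vanish, and this drops the multiple.
  x+y*0 : ∀ {x y z} → z ≈ 0# → x + y * z ≈ x
  x+y*0 {x} {y} z≈0 = trans (+-congˡ (trans (*-congˡ z≈0) (zeroʳ y))) (+-identityʳ x)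

-- Fermat's little theorem for a finite set of field elements

module FermatLittle (R : CommutativeRing 0ℓ 0ℓ) (isField : IsField R) (q : ℕ)
    (_≟_ : ∀ x y → Dec (CommutativeRing._≈_ R x y)) where
  open CommutativeRing R hiding (zero)
  open IsField isField
  open Geometry R q using (pow)
  open FieldProperties R isField
  open SetoidReasoning setoid
  open Algebra.Properties.CommutativeMonoid.Sum *-commutativeMonoid
    renaming (sum to product; sum-permute to product-permute; sum-cong-≋ to product-cong;
              sum-remove to product-remove; ∑-distrib-+ to product-distrib-*; sum-replicate-zero to product-1s)

  product-const : ∀ x m → product {m} (λ _ → x) ≈ pow x m
  product-const x zero = refl
  product-const x (suc m) = *-congˡ (product-const x m)

  product-≉0 : ∀ m (h : Fin m → Carrier) → (∀ i → ¬ h i ≈ 0#) → ¬ product h ≈ 0#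
  product-≉0 zero h h≉0 eq = 0≉1 (sym eq)
  product-≉0 (suc m) h h≉0 = *-≉0 (h≉0 zero) (product-≉0 m (h ∘ suc) (h≉0 ∘ suc))

  product-single : ∀ {m} (h : Fin m → Carrier) i → (∀ j → ¬ j ≡ i → h j ≈ 1#) → product h ≈ h i
  product-single {suc m} h i h≈1 = begin
    product h
      ≈⟨ product-remove {i = i} h ⟩
    h i * product (λ j → h (punchIn i j))
      ≈⟨ *-congˡ (product-cong {m} (λ j → h≈1 (punchIn i j) (punchInᵢ≢i i j))) ⟩
    h i * product {m} (λ _ → 1#)
      ≈⟨ *-congˡ (product-1s m) ⟩
    h i * 1#
      ≈⟨ *-identityʳ (h i) ⟩
    h i ∎

  -- Serves two purposes: it turns the factor 0 into 1, so that the product over all of P is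
  -- nonzero, and it marks the index of 0, where one surplus factor x is left over. The exponent m
  -- thus appears directly, without m - 1.
  if0 : Carrier → Carrier → Carrier → Carrier
  if0 y a b with y ≟ 0#
  ... | yes _ = a
  ... | no _ = b

  if0-≈0 : ∀ {y} a b → y ≈ 0# → if0 y a b ≈ a
  if0-≈0 {y} a b y≈0 with y ≟ 0#
  ... | yes _ = refl
  ... | no y≉0 = contradiction y≈0 y≉0

  if0-≉0 : ∀ {y} a b → ¬ y ≈ 0# → if0 y a b ≈ b
  if0-≉0 {y} a b y≉0 with y ≟ 0#
  ... | yes y≈0 = contradiction y≈0 y≉0
  ... | no _ = refl

  private
    variable
      P : Carrier → Set
      m : ℕ

  -- The product of the nonzero elements of P is multiplied by x^{m-1} and permuted when each factor is multiplied by x.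
  fermat-≉0 : Enum _≈_ P m → P 0# → ∀ x → ¬ x ≈ 0# →
    (∀ y → P y → P (x * y)) → (∀ y → P (x * y) → P y) → (∀ {y z} → y ≈ z → P y → P z) →
    pow x m ≈ x
  fermat-≉0 {P} {m} E P0 x x≉0 P* P/ resp =
    *-cancel-≉0 (product-≉0 m _ nz-≉0) (trans (*-comm _ _) (trans powers (*-comm _ _)))
    where
    nz : Carrier → Carrier
    nz y = if0 y 1# y

    nz-≉0 : ∀ i → ¬ nz (to E i) ≈ 0#
    nz-≉0 i with to E i ≟ 0#
    ... | yes _ = 0≉1 ∘ sym
    ... | no y≉0 = y≉0

    nz-cong : ∀ {y z} → y ≈ z → nz y ≈ nz z
    nz-cong {y} {z} y≈z with y ≟ 0#
    ... | yes y≈0 = sym (if0-≈0 1# z (trans (sym y≈z) y≈0))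
    ... | no y≉0 = trans y≈z (sym (if0-≉0 1# z (y≉0 ∘ trans y≈z)))

    i⁻¹ : Carrier
    i⁻¹ = proj₁ (inverse x x≉0)

    cancel : ∀ y → x * (i⁻¹ * y) ≈ y
    cancel y = trans (sym (*-assoc _ _ _))
      (trans (*-congʳ (proj₂ (inverse x x≉0))) (*-identityˡ y))

    forth : ∀ i → ∃ λ j → to E j ≈ x * to E i
    forth i = index E (x * to E i) (P* _ (to-in E i))
    back : ∀ i → ∃ λ j → to E j ≈ i⁻¹ * to E i
    back i = index E (i⁻¹ * to E i) (P/ _ (resp (sym (cancel _)) (to-in E i)))

    perm = permutation (proj₁ ∘ forth) (proj₁ ∘ back)
      (λ j → to-inj E _ _ (trans (proj₂ (forth _)) (trans (*-congˡ (proj₂ (back j))) (cancel _))))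
      (λ i → to-inj E _ _ (*-cancel-≉0 x≉0
        (trans (*-congˡ (proj₂ (back _))) (trans (cancel _) (proj₂ (forth i))))))

    zero-index = index E 0# P0

    x-at-0 : Fin m → Carrier
    x-at-0 i = if0 (to E i) x 1#

    x-scales : ∀ i → x * nz (to E i) ≈ x-at-0 i * nz (x * to E i)
    x-scales i with to E i ≟ 0#
    ... | yes y≈0 = *-congˡ (sym (if0-≈0 1# _ (trans (*-congˡ y≈0) (zeroʳ x))))
    ... | no y≉0 = trans (sym (*-identityˡ _)) (*-congˡ (sym (if0-≉0 1# _ (*-≉0 x≉0 y≉0))))

    powers : pow x m * product (nz ∘ to E) ≈ x * product (nz ∘ to E)
    powers = begin
      pow x m * product (nz ∘ to E)
        ≈⟨ *-congʳ (product-const x m) ⟨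
      product {m} (λ _ → x) * product (nz ∘ to E)
        ≈⟨ product-distrib-* {m} (λ _ → x) (nz ∘ to E) ⟨
      product (λ i → x * nz (to E i))
        ≈⟨ product-cong x-scales ⟩
      product (λ i → x-at-0 i * nz (x * to E i))
        ≈⟨ product-distrib-* x-at-0 _ ⟩
      product x-at-0 * product (λ i → nz (x * to E i))
        ≈⟨ *-cong
             (trans (product-single x-at-0 (proj₁ zero-index)
                      (λ j j≢ → if0-≉0 x 1# (λ y≈0 → j≢ (to-inj E _ _ (trans y≈0 (sym (proj₂ zero-index)))))))
                    (if0-≈0 x 1# (proj₂ zero-index)))
             (product-cong (λ i → nz-cong (sym (proj₂ (forth i))))) ⟩
      x * product (λ i → nz (to E (perm ⟨$⟩ʳ i)))
        ≈⟨ *-congˡ (product-permute (nz ∘ to E) perm) ⟨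
      x * product (nz ∘ to E) ∎

  fermat : Enum _≈_ P m → P 0# → ∀ x →
    (¬ x ≈ 0# → (∀ y → P y → P (x * y)) × (∀ y → P (x * y) → P y)) →
    (∀ {y z} → y ≈ z → P y → P z) → pow x m ≈ x
  fermat {P} {m} E P0 x closed resp with x ≟ 0#
  ... | no x≉0 = fermat-≉0 E P0 x x≉0 (proj₁ (closed x≉0)) (proj₂ (closed x≉0)) resp
  -- The index of 0 is an element of Fin m, so m is positive and 0^m = 0.
  ... | yes x≈0 with m | proj₁ (index E 0# P0)
  ... | suc _ | _ = trans (*-congʳ x≈0) (trans (zeroˡ _) (sym x≈0))

-- The fixed field of an automorphism of order 3

record IsOrder3Automorphism (R : CommutativeRing 0ℓ 0ℓ) (f : CommutativeRing.Carrier R → CommutativeRing.Carrier R) : Set where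
  open CommutativeRing R
  field
    f-cong : ∀ {x y} → x ≈ y → f x ≈ f y
    f-+ : ∀ x y → f (x + y) ≈ f x + f y
    f-* : ∀ x y → f (x * y) ≈ f x * f y
    f-1 : f 1# ≈ 1#
    f³ : ∀ x → f (f (f x)) ≈ x
    moved : ∃ λ θ → ¬ f θ ≈ θ

cube-injective : ∀ m n → m ℕ.* (m ℕ.* m) ≡ n ℕ.* (n ℕ.* n) → m ≡ n
cube-injective m n eq with ℕ.<-cmp m n
... | tri≈ _ m≡n _ = m≡n
... | tri< m<n _ _ = contradiction eq (ℕ.<⇒≢ (ℕ.*-mono-< m<n (ℕ.*-mono-< m<n m<n)))
... | tri> _ _ n<m = contradiction (≡.sym eq) (ℕ.<⇒≢ (ℕ.*-mono-< n<m (ℕ.*-mono-< n<m n<m)))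

module FixedField (R : CommutativeRing 0ℓ 0ℓ) (isField : IsField R) (q : ℕ)
    (K-enum : Enum (CommutativeRing._≈_ R) (λ _ → ⊤) (q ℕ.^ 3))
    (f : CommutativeRing.Carrier R → CommutativeRing.Carrier R)
    (isAut : IsOrder3Automorphism R f) where
  open CommutativeRing R hiding (zero)
  open IsField isField
  open Geometry R q using (pow)
  open FieldProperties R isField
  open IsOrder3Automorphism isAut
  open RingSolver R
  open SetoidReasoning setoid
  open Algebra.Properties.Ring ring using (x+x≈x⇒x≈0)
  open Algebra.Properties.Group +-group using (inverseˡ-unique)
  open Enumerations isEquivalence
  open FermatLittle R isField q (Enum-≟ K-enum) using (fermat)

  f-0 : f 0# ≈ 0#
  f-0 = x+x≈x⇒x≈0 (f 0#) (trans (sym (f-+ 0# 0#)) (f-cong (+-identityˡ 0#)))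

  f-neg : ∀ x → f (- x) ≈ - f x
  f-neg x = inverseˡ-unique _ _ (trans (sym (f-+ _ _)) (trans (f-cong (-‿inverseˡ x)) f-0))

  f-sub : ∀ x y → f (x - y) ≈ f x - f y
  f-sub x y = trans (f-+ _ _) (+-congˡ (f-neg y))

  f-inj : ∀ {x y} → f x ≈ f y → x ≈ y
  f-inj {x} {y} eq = trans (sym (f³ x)) (trans (f-cong (f-cong eq)) (f³ y))

  Fix : Carrier → Set
  Fix x = f x ≈ x

  Fix-resp : ∀ {x y} → x ≈ y → Fix x → Fix y
  Fix-resp x≈y fx = trans (f-cong (sym x≈y)) (trans fx x≈y)

  Fix-+ : ∀ {x y} → Fix x → Fix y → Fix (x + y)
  Fix-+ fx fy = trans (f-+ _ _) (+-cong fx fy)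

  Fix-* : ∀ {x y} → Fix x → Fix y → Fix (x * y)
  Fix-* fx fy = trans (f-* _ _) (*-cong fx fy)

  Fix-neg : ∀ {x} → Fix x → Fix (- x)
  Fix-neg fx = trans (f-neg _) (-‿cong fx)

  Fix-/ : ∀ {x y} → ¬ x ≈ 0# → Fix x → Fix (x * y) → Fix y
  Fix-/ x≉0 fx fxy = *-cancel-≉0 x≉0 (trans (*-congʳ (sym fx)) (trans (sym (f-* _ _)) fxy))

  -- The conjugates of a moved element are pairwise distinct because f³ is the identity; hence 1,
  -- θ₀, θ₀² will be a basis of K over the fixed field.
  θ₀ θ₁ θ₂ : Carrier
  θ₀ = proj₁ moved
  θ₁ = f θ₀
  θ₂ = f θ₁

  θ₀≉θ₁ : ¬ θ₀ ≈ θ₁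
  θ₀≉θ₁ = proj₂ moved ∘ sym

  θ₁≉θ₂ : ¬ θ₁ ≈ θ₂
  θ₁≉θ₂ = θ₀≉θ₁ ∘ f-inj

  θ₀≉θ₂ : ¬ θ₀ ≈ θ₂
  θ₀≉θ₂ eq = θ₁≉θ₂ (trans (trans (f-cong eq) (f³ θ₀)) eq)

  -- Divided differences: the secants from x to y and from x to z give two linear relations, and
  -- their difference isolates c.
  vandermonde : ∀ {x y z a b c} → ¬ x ≈ y → ¬ y ≈ z → ¬ x ≈ z →
    a + (b * x + c * (x * x)) ≈ 0# → a + (b * y + c * (y * y)) ≈ 0# → a + (b * z + c * (z * z)) ≈ 0# →
    a ≈ 0# × b ≈ 0# × c ≈ 0#
  vandermonde {x} {y} {z} {a} {b} {c} x≉y y≉z x≉z at-x at-y at-z = a≈0 , b≈0 , c≈0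
    where
    secant : ∀ {y} → ¬ x ≈ y → a + (b * y + c * (y * y)) ≈ 0# → b + c * (x + y) ≈ 0#
    secant {y} x≉y at-y = xy≈0⇒y≈0 (x-y≉0 x≉y) (begin
      (x - y) * (b + c * (x + y))
        ≈⟨ solve 5 (λ a b c x y → (x :- y) :* (b :+ c :* (x :+ y)) :=
             (a :+ (b :* x :+ c :* (x :* x))) :- (a :+ (b :* y :+ c :* (y :* y)))) refl a b c x y ⟩
      (a + (b * x + c * (x * x))) - (a + (b * y + c * (y * y)))
        ≈⟨ x≈y⇒x-y≈0 (trans at-x (sym at-y)) ⟩
      0# ∎)
    c≈0 : c ≈ 0#
    c≈0 = xy≈0⇒y≈0 (x-y≉0 y≉z) (begin
      (y - z) * c
        ≈⟨ solve 5 (λ b c x y z → (y :- z) :* c := (b :+ c :* (x :+ y)) :- (b :+ c :* (x :+ z))) refl b c x y z ⟩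
      (b + c * (x + y)) - (b + c * (x + z))
        ≈⟨ x≈y⇒x-y≈0 (trans (secant x≉y at-y) (sym (secant x≉z at-z))) ⟩
      0# ∎)
    b≈0 : b ≈ 0#
    b≈0 = begin
      b                 ≈⟨ x+y*0 c≈0 ⟨
      b + (x + y) * c   ≈⟨ +-congˡ (*-comm _ _) ⟩
      b + c * (x + y)   ≈⟨ secant x≉y at-y ⟩
      0# ∎
    a≈0 : a ≈ 0#
    a≈0 = begin
      a                           ≈⟨ x+y*0 b≈0 ⟨
      a + x * b                   ≈⟨ x+y*0 c≈0 ⟨
      a + x * b + x * x * c       ≈⟨ solve 4 (λ a b c x → a :+ x :* b :+ x :* x :* c := a :+ (b :* x :+ c :* (x :* x))) refl a b c x ⟩
      a + (b * x + c * (x * x))   ≈⟨ at-x ⟩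
      0# ∎

  Triple : Set
  Triple = Carrier × Carrier × Carrier

  _≈³_ : Triple → Triple → Set
  _≈³_ = Pointwise _≈_ (Pointwise _≈_ _≈_)

  Fix³ : Triple → Set
  Fix³ (a , b , c) = Fix a × Fix b × Fix c

  eval : Triple → Carrier → Carrier
  eval (a , b , c) x = a + (b * x + c * (x * x))

  eval-cong : ∀ {p r x y} → p ≈³ r → x ≈ y → eval p x ≈ eval r y
  eval-cong (a≈ , b≈ , c≈) x≈y = +-cong a≈ (+-cong (*-cong b≈ x≈y) (*-cong c≈ (*-cong x≈y x≈y)))

  f-eval : ∀ p x → Fix³ p → f (eval p x) ≈ eval p (f x)
  f-eval (a , b , c) x (fa , fb , fc) = trans (f-+ _ _) (+-cong fa (trans (f-+ _ _)
    (+-cong (trans (f-* _ _) (*-congʳ fb)) (trans (f-* _ _) (*-cong fc (f-* _ _))))))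

  -- The coefficients are fixed by f, so an equality at θ₀ propagates to its conjugates, and a
  -- quadratic with three distinct roots is zero.
  eval-inj : ∀ {p r} → Fix³ p → Fix³ r → eval p θ₀ ≈ eval r θ₀ → p ≈³ r
  eval-inj {p@(a , b , c)} {r@(a′ , b′ , c′)} fp fr eq₀ =
    let (a≈ , b≈ , c≈) = vandermonde θ₀≉θ₁ θ₁≉θ₂ θ₀≉θ₂ (diff eq₀) (diff eq₁) (diff eq₂)
    in x-y≈0⇒x≈y _ _ a≈ , x-y≈0⇒x≈y _ _ b≈ , x-y≈0⇒x≈y _ _ c≈
    where
    step : ∀ {x} → eval p x ≈ eval r x → eval p (f x) ≈ eval r (f x)
    step eq = trans (sym (f-eval p _ fp)) (trans (f-cong eq) (f-eval r _ fr))
    eq₁ : eval p θ₁ ≈ eval r θ₁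
    eq₁ = step eq₀
    eq₂ : eval p θ₂ ≈ eval r θ₂
    eq₂ = step eq₁
    diff : ∀ {x} → eval p x ≈ eval r x → eval (a - a′ , b - b′ , c - c′) x ≈ 0#
    diff {x} eq = trans
      (solve 7 (λ a b c a′ b′ c′ x →
          (a :- a′) :+ ((b :- b′) :* x :+ (c :- c′) :* (x :* x)) :=
          (a :+ (b :* x :+ c :* (x :* x))) :- (a′ :+ (b′ :* x :+ c′ :* (x :* x))))
        refl a b c a′ b′ c′ x)
      (x≈y⇒x-y≈0 eq)

  -- Brings coefficients into the fixed field: the interpolating quadratic is the sum of the
  -- conjugates of y (X - θ₁)(X - θ₂), so each of its coefficients is a trace. At θ₀ only the first
  -- summand survives.
  trace : Carrier → Carrier
  trace x = x + f x + f (f x)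

  trace-fixed : ∀ x → Fix (trace x)
  trace-fixed x = begin
    f (x + f x + f (f x))             ≈⟨ trans (f-+ _ _) (+-congʳ (f-+ _ _)) ⟩
    f x + f (f x) + f (f (f x))       ≈⟨ +-congˡ (f³ x) ⟩
    f x + f (f x) + x                 ≈⟨ solve 3 (λ x y z → y :+ z :+ x := x :+ y :+ z) refl x (f x) (f (f x)) ⟩
    x + f x + f (f x) ∎

  trace-* : ∀ y {z z₁ z₂} → f z ≈ z₁ → f z₁ ≈ z₂ → trace (y * z) ≈ y * z + f y * z₁ + f (f y) * z₂
  trace-* y eq₁ eq₂ = +-cong (+-congˡ (trans (f-* _ _) (*-congˡ eq₁)))
    (trans (f-cong (trans (f-* _ _) (*-congˡ eq₁))) (trans (f-* _ _) (*-congˡ eq₂)))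

  -- Lagrange interpolation of the conjugates of x at the conjugates of θ₀.
  abstract
    eval-surj : ∀ x → ∃ λ p → Fix³ p × eval p θ₀ ≈ x
    eval-surj x = (trace (y * (θ₁ * θ₂)) , trace (y * (- (θ₁ + θ₂))) , trace y) ,
      (trace-fixed _ , trace-fixed _ , trace-fixed _) , (begin
        trace (y * (θ₁ * θ₂)) + (trace (y * (- (θ₁ + θ₂))) * θ₀ + trace y * (θ₀ * θ₀))
          ≈⟨ +-cong (trace-* y (trans (f-* _ _) (*-congˡ (f³ θ₀))) (trans (f-* _ _) (*-congʳ (f³ θ₀))))
               (+-congʳ (*-congʳ (trace-* y
                 (trans (f-neg _) (-‿cong (trans (f-+ _ _) (+-congˡ (f³ θ₀)))))
                 (trans (f-neg _) (-‿cong (trans (f-+ _ _) (+-congʳ (f³ θ₀)))))))) ⟩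
        (y * (θ₁ * θ₂) + f y * (θ₂ * θ₀) + f (f y) * (θ₀ * θ₁)) +
          ((y * (- (θ₁ + θ₂)) + f y * (- (θ₂ + θ₀)) + f (f y) * (- (θ₀ + θ₁))) * θ₀ + trace y * (θ₀ * θ₀))
          ≈⟨ solve 6 (λ y y₁ y₂ θ₀ θ₁ θ₂ →
               (y :* (θ₁ :* θ₂) :+ y₁ :* (θ₂ :* θ₀) :+ y₂ :* (θ₀ :* θ₁)) :+
               ((y :* (:- (θ₁ :+ θ₂)) :+ y₁ :* (:- (θ₂ :+ θ₀)) :+ y₂ :* (:- (θ₀ :+ θ₁))) :* θ₀ :+
                (y :+ y₁ :+ y₂) :* (θ₀ :* θ₀)) := ((θ₀ :- θ₁) :* (θ₀ :- θ₂)) :* y)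
               refl y (f y) (f (f y)) θ₀ θ₁ θ₂ ⟩
        D * y
          ≈⟨ solve 3 (λ d i x → d :* (x :* i) := x :* (d :* i)) refl D (proj₁ D-inv) x ⟩
        x * (D * proj₁ D-inv)
          ≈⟨ trans (*-congˡ (proj₂ D-inv)) (*-identityʳ x) ⟩
        x ∎)
      where
      D : Carrier
      D = (θ₀ - θ₁) * (θ₀ - θ₂)
      D-inv : ∃ λ i → D * i ≈ 1#
      D-inv = inverse D (*-≉0 (x-y≉0 θ₀≉θ₁) (x-y≉0 θ₀≉θ₂))
      y : Carrier
      y = x * proj₁ D-inv

  private
    Fix-finite : ∃ λ m → Enum _≈_ Fix m
    Fix-finite = Enum-filter (λ x → Enum-≟ K-enum (f x) x) Fix-resp K-enum

    m : ℕ
    m = proj₁ Fix-finite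

    K-enum′ : Enum _≈_ (λ _ → ⊤) (m ℕ.* (m ℕ.* m))
    K-enum′ = Enum-cong (λ _ _ → tt) (λ x _ → eval-surj x)
      (Images.Enum-image isEquivalence (λ p → eval p θ₀) (λ p≈r → eval-cong p≈r refl) eval-inj
        (Enum-× F (Enum-× F F)))
      where F = proj₂ Fix-finite

    -- K is enumerated twice, by m³ coefficient triples and by the given q³ indices.
    m≡q : m ≡ q
    m≡q = cube-injective m q (≡.trans
      (ℕ.≤-antisym (Enum-⊆⇒≤ K-enum′ K-enum (λ _ _ → tt)) (Enum-⊆⇒≤ K-enum K-enum′ (λ _ _ → tt)))
      (cong (λ k → q ℕ.* (q ℕ.* k)) (ℕ.*-identityʳ q)))

  abstract
    Fix-enum : Enum _≈_ Fix q
    Fix-enum = ≡.subst (Enum _≈_ Fix) m≡q (proj₂ Fix-finite)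

    -- Multiplication by a nonzero fixed element permutes the q fixed elements, so Fermat's argument
    -- applies. This is the inclusion of the fixed field in `InF`.
    Fix⇒pow : ∀ {x} → Fix x → pow x q ≈ x
    Fix⇒pow {x} fx = fermat Fix-enum f-0 x
      (λ x≉0 → (λ y → Fix-* fx) , (λ y → Fix-/ x≉0 fx)) Fix-resp

    -- Dedekind's independence of the characters id, f and f²; the values 1, θ₀ and θ₀² already witness it.
    nonvanishing : ∀ a b c → ¬ a ≈ 0# → ∃ λ η → ¬ a * η + b * f η + c * f (f η) ≈ 0#
    nonvanishing a b c a≉0 with Enum-≟ K-enum (L 1#) 0# | Enum-≟ K-enum (L θ₀) 0# | Enum-≟ K-enum (L (θ₀ * θ₀)) 0#
      where
      L : Carrier → Carrier
      L η = a * η + b * f η + c * f (f η)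
    ... | no at-1 | _ | _ = 1# , at-1
    ... | _ | no at-θ | _ = θ₀ , at-θ
    ... | _ | _ | no at-θ² = θ₀ * θ₀ , at-θ²
    ... | yes at-1 | yes at-θ | yes at-θ² = contradiction
      (begin
        (a * ((θ₀ - θ₁) * (θ₀ - θ₂)))
          ≈⟨ solve 6 (λ a b c θ₀ θ₁ θ₂ → a :* ((θ₀ :- θ₁) :* (θ₀ :- θ₂)) :=
               (a :* (θ₀ :* θ₀) :+ b :* (θ₁ :* θ₁) :+ c :* (θ₂ :* θ₂)) :+
               (:- (θ₁ :+ θ₂)) :* (a :* θ₀ :+ b :* θ₁ :+ c :* θ₂) :+
               θ₁ :* θ₂ :* (a :* :1 :+ b :* :1 :+ c :* :1)) refl a b c θ₀ θ₁ θ₂ ⟩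
        (a * (θ₀ * θ₀) + b * (θ₁ * θ₁) + c * (θ₂ * θ₂)) + (- (θ₁ + θ₂)) * (a * θ₀ + b * θ₁ + c * θ₂)
          + θ₁ * θ₂ * (a * 1# + b * 1# + c * 1#)
          ≈⟨ x+y*0 (trans (+-cong (+-congˡ (*-congˡ (sym f-1))) (*-congˡ (trans (sym f-1) (f-cong (sym f-1))))) at-1) ⟩
        (a * (θ₀ * θ₀) + b * (θ₁ * θ₁) + c * (θ₂ * θ₂)) + (- (θ₁ + θ₂)) * (a * θ₀ + b * θ₁ + c * θ₂)
          ≈⟨ x+y*0 at-θ ⟩
        a * (θ₀ * θ₀) + b * (θ₁ * θ₁) + c * (θ₂ * θ₂)
          ≈⟨ +-cong (+-congˡ (*-congˡ (f-* _ _))) (*-congˡ (trans (f-cong (f-* _ _)) (f-* _ _))) ⟨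
        a * (θ₀ * θ₀) + b * f (θ₀ * θ₀) + c * f (f (θ₀ * θ₀))
          ≈⟨ at-θ² ⟩
        0# ∎)
      (*-≉0 a≉0 (*-≉0 (x-y≉0 θ₀≉θ₁) (x-y≉0 θ₀≉θ₂)))

-- The kernel of the cofactor on a single coordinate

-- In coordinates with respect to e₁, e₂, e₃ the map σ acts by g on each of the three components.
module TwistedKernel (R : CommutativeRing 0ℓ 0ℓ) (isField : IsField R) (q : ℕ)
    (K-enum : Enum (CommutativeRing._≈_ R) (λ _ → ⊤) (q ℕ.^ 3))
    (f : CommutativeRing.Carrier R → CommutativeRing.Carrier R)
    (isAut : IsOrder3Automorphism R f)
    (μ ℓ : CommutativeRing.Carrier R) where
  open CommutativeRing R hiding (zero)
  open IsField isField
  open FieldProperties R isField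
  open IsOrder3Automorphism isAut
  open FixedField R isField q K-enum f isAut
  open RingSolver R
  open SetoidReasoning setoid

  g : Carrier → Carrier
  g x = μ * f x

  g-cong : ∀ {x y} → x ≈ y → g x ≈ g y
  g-cong x≈y = *-congˡ (f-cong x≈y)

  g-+ : ∀ x y → g (x + y) ≈ g x + g y
  g-+ x y = trans (*-congˡ (f-+ x y)) (distribˡ μ _ _)

  g-sub : ∀ x y → g (x - y) ≈ g x - g y
  g-sub x y = trans (*-congˡ (f-sub x y)) (solve 3 (λ m x y → m :* (x :- y) := m :* x :- m :* y) refl μ (f x) (f y))

  g-scale : ∀ {a} → Fix a → ∀ x → g (a * x) ≈ a * g x
  g-scale {a} fa x = trans (*-congˡ (trans (f-* a x) (*-congʳ fa)))
    (solve 3 (λ m a x → m :* (a :* x) := a :* (m :* x)) refl μ a (f x))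

  T : Carrier → Carrier
  T x = g (g x) + (ℓ * g x + ℓ * ℓ * x)

  -- The Casorati determinant of x and y, an analogue of the Wronskian with g in place of the
  -- derivation. It certifies independence over the fixed field and supplies the determinants of
  -- Cramer's rule.
  W : Carrier → Carrier → Carrier
  W x y = x * g y - y * g x

  W-linear : ∀ {a} → Fix a → ∀ x y z → W (a * x + y) z ≈ a * W x z + W y z
  W-linear {a} fa x y z = trans
    (+-congˡ (-‿cong (*-congˡ (trans (g-+ (a * x) y) (+-congʳ (g-scale fa x))))))
    (solve 7 (λ a x y z gx gy gz → (a :* x :+ y) :* gz :- z :* (a :* gx :+ gy) :=
        a :* (x :* gz :- z :* gx) :+ (y :* gz :- z :* gy)) refl a x y z (g x) (g y) (g z))

  W-congˡ : ∀ {x y} z → x ≈ y → W x z ≈ W y z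
  W-congˡ z x≈y = +-cong (*-congʳ x≈y) (-‿cong (*-congˡ (g-cong x≈y)))

  W-0 : ∀ z → W 0# z ≈ 0#
  W-0 z = trans (+-cong (zeroˡ _) (-‿cong (trans (*-congˡ (trans (*-congˡ f-0) (zeroʳ μ))) (zeroʳ z)))) (-‿inverseʳ 0#)

  module Basis (μ≉0 : ¬ μ ≈ 0#) (ℓ≉0 : ¬ ℓ ≈ 0#) (fixed-ℓ : Fix ℓ)
      (g³ : ∀ x → g (g (g x)) ≈ (ℓ * (ℓ * ℓ)) * x) where

    -- The factorisation (g² + ℓ g + ℓ²)(g - ℓ) = g³ - ℓ³, valid because g commutes with the fixed
    -- scalar ℓ.
    T-image : ∀ x → T (g x - ℓ * x) ≈ 0#
    T-image x = begin
      g (g (g x - ℓ * x)) + (ℓ * g (g x - ℓ * x) + ℓ * ℓ * (g x - ℓ * x))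
        ≈⟨ +-cong (trans (g-cong once) twice) (+-congʳ (*-congˡ once)) ⟩
      ((ℓ * (ℓ * ℓ)) * x - ℓ * g (g x)) + (ℓ * (g (g x) - ℓ * g x) + ℓ * ℓ * (g x - ℓ * x))
        ≈⟨ solve 4 (λ l x gx ggx → ((l :* (l :* l)) :* x :- l :* ggx) :+
             (l :* (ggx :- l :* gx) :+ l :* l :* (gx :- l :* x)) := :0) refl ℓ x (g x) (g (g x)) ⟩
      0# ∎
      where
      once : g (g x - ℓ * x) ≈ g (g x) - ℓ * g x
      once = trans (g-sub _ _) (+-congˡ (-‿cong (g-scale fixed-ℓ x)))
      twice : g (g (g x) - ℓ * g x) ≈ (ℓ * (ℓ * ℓ)) * x - ℓ * g (g x)
      twice = trans (g-sub _ _) (+-cong (g³ x) (-‿cong (g-scale fixed-ℓ (g x))))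

    T≈0⇒g² : ∀ {x} → T x ≈ 0# → g (g x) ≈ - (ℓ * g x + ℓ * ℓ * x)
    T≈0⇒g² {x} Tx = x-y≈0⇒x≈y _ _ (trans
      (solve 4 (λ l x gx ggx → ggx :- (:- (l :* gx :+ l :* l :* x)) := ggx :+ (l :* gx :+ l :* l :* x)) refl ℓ x (g x) (g (g x)))
      Tx)

    -- On the kernel g² = -ℓ g - ℓ², so g takes the pair (x, g x) to its product with a companion
    -- matrix of determinant ℓ². The left side is the determinant W with g applied to every entry.
    f-W : ∀ {x y} → T x ≈ 0# → T y ≈ 0# → (μ * μ) * f (W x y) ≈ (ℓ * ℓ) * W x y
    f-W {x} {y} Tx Ty = begin
      (μ * μ) * f (x * g y - y * g x)
        ≈⟨ *-congˡ (trans (f-sub _ _) (+-cong (f-* _ _) (-‿cong (f-* _ _)))) ⟩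
      (μ * μ) * (f x * f (g y) - f y * f (g x))
        ≈⟨ solve 5 (λ m a b c d → (m :* m) :* (a :* b :- c :* d) := (m :* a) :* (m :* b) :- (m :* c) :* (m :* d))
             refl μ (f x) (f (g y)) (f y) (f (g x)) ⟩
      g x * g (g y) - g y * g (g x)
        ≈⟨ +-cong (*-congˡ (T≈0⇒g² Ty)) (-‿cong (*-congˡ (T≈0⇒g² Tx))) ⟩
      g x * (- (ℓ * g y + ℓ * ℓ * y)) - g y * (- (ℓ * g x + ℓ * ℓ * x))
        ≈⟨ solve 5 (λ l x y gx gy → gx :* (:- (l :* gy :+ l :* l :* y)) :- gy :* (:- (l :* gx :+ l :* l :* x))
             := (l :* l) :* (x :* gy :- y :* gx)) refl ℓ x y (g x) (g y) ⟩
      (ℓ * ℓ) * W x y ∎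

    private
      first : ∃ λ η → ¬ (- ℓ) * η + μ * f η + 0# * f (f η) ≈ 0#
      first = nonvanishing (- ℓ) μ 0# (λ -ℓ≈0 → ℓ≉0 (x-y≈0⇒x≈y _ _
        (trans (solve 1 (λ l → l :- :0 := (:- :1) :* (:- l)) refl ℓ) (trans (*-congˡ -ℓ≈0) (zeroʳ _)))))

    -- The basis vectors of the kernel are sought in the image of g - ℓ: a hwise-fixed space will be
    -- known to contain exactly such values.
    η₁ s : Carrier
    η₁ = proj₁ first
    s = g η₁ - ℓ * η₁

    s≉0 : ¬ s ≈ 0#
    s≉0 s≈0 = proj₂ first (trans
      (solve 5 (λ l m x y z → (:- l) :* x :+ m :* y :+ :0 :* z := m :* y :- l :* x) refl ℓ μ η₁ (f η₁) (f (f η₁)))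
      s≈0)

    private
      gs≉0 : ¬ g s ≈ 0#
      gs≉0 = *-≉0 μ≉0 (λ fs≈0 → s≉0 (f-inj (trans fs≈0 (sym f-0))))

      -- The coefficients come from expanding W s (g η - ℓ η) in η, f η and f² η; the first of them,
      -- ℓ g s, is nonzero.
      second : ∃ λ η → ¬ (ℓ * g s) * η + (- (s * ℓ + g s) * μ) * f η + (s * μ * f μ) * f (f η) ≈ 0#
      second = nonvanishing _ _ _ (*-≉0 ℓ≉0 gs≉0)

    η₂ t : Carrier
    η₂ = proj₁ second
    t = g η₂ - ℓ * η₂

    W-st≉0 : ¬ W s t ≈ 0#
    W-st≉0 W≈0 = proj₂ second (begin
      (ℓ * g s) * η₂ + (- (s * ℓ + g s) * μ) * f η₂ + (s * μ * f μ) * f (f η₂)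
        ≈⟨ solve 8 (λ l s gs η fη m fm ffη →
             (l :* gs) :* η :+ ((:- (s :* l :+ gs)) :* m) :* fη :+ (s :* m :* fm) :* ffη :=
             s :* (m :* (fm :* ffη) :- l :* (m :* fη)) :- (m :* fη :- l :* η) :* gs)
             refl ℓ s (g s) η₂ (f η₂) μ (f μ) (f (f η₂)) ⟩
      s * (μ * (f μ * f (f η₂)) - ℓ * g η₂) - t * g s
        ≈⟨ +-congʳ (*-congˡ (+-cong (*-congˡ (f-* _ _)) (-‿cong (g-scale fixed-ℓ η₂)))) ⟨
      s * (g (g η₂) - g (ℓ * η₂)) - t * g s
        ≈⟨ +-congʳ (*-congˡ (g-sub _ _)) ⟨
      W s t
        ≈⟨ W≈0 ⟩
      0# ∎)

    t≉0 : ¬ t ≈ 0#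
    t≉0 t≈0 = W-st≉0 (trans (+-cong
      (trans (*-congˡ (trans (g-cong t≈0) (trans (*-congˡ f-0) (zeroʳ μ)))) (zeroʳ s))
      (-‿cong (trans (*-congʳ t≈0) (zeroˡ _)))) (-‿inverseʳ 0#))

    -- By f-W all the values of W on the kernel of T are scaled by f in the same way, so Cramer's rule gives
    -- coefficients fixed by f.
    kernel-coordinates : ∀ r → T r ≈ 0# → ∃ λ a → ∃ λ b → Fix a × Fix b × r ≈ a * s + b * t
    kernel-coordinates r Tr = W r t * i , W s r * i , ratio-fixed Tr Tt , ratio-fixed Ts Tr , (begin
      r
        ≈⟨ trans (*-congˡ D-inv) (*-identityʳ r) ⟨
      r * (W s t * i)
        ≈⟨ solve 7 (λ r s t gr gs gt i → r :* ((s :* gt :- t :* gs) :* i) :=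
             ((r :* gt :- t :* gr) :* i) :* s :+ ((s :* gr :- r :* gs) :* i) :* t) refl r s t (g r) (g s) (g t) i ⟩
      W r t * i * s + W s r * i * t ∎)
      where
      Ts : T s ≈ 0#
      Ts = T-image η₁
      Tt : T t ≈ 0#
      Tt = T-image η₂
      i : Carrier
      i = proj₁ (inverse (W s t) W-st≉0)
      D-inv : W s t * i ≈ 1#
      D-inv = proj₂ (inverse (W s t) W-st≉0)
      ratio-fixed : ∀ {x y} → T x ≈ 0# → T y ≈ 0# → Fix (W x y * i)
      ratio-fixed {x} {y} Tx Ty = *-cancel-≉0 (*-≉0 (*-≉0 ℓ≉0 ℓ≉0) W-st≉0) (begin
        ((ℓ * ℓ) * W s t) * f (W x y * i)
          ≈⟨ *-cong (sym (f-W Ts Tt)) (f-* _ _) ⟩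
        ((μ * μ) * f (W s t)) * (f (W x y) * f i)
          ≈⟨ solve 4 (λ m a b c → (m :* a) :* (b :* c) := (m :* b) :* (a :* c)) refl (μ * μ) (f (W s t)) (f (W x y)) (f i) ⟩
        ((μ * μ) * f (W x y)) * (f (W s t) * f i)
          ≈⟨ *-cong (f-W Tx Ty) (trans (sym (f-* _ _)) (trans (f-cong D-inv) f-1)) ⟩
        ((ℓ * ℓ) * W x y) * 1#
          ≈⟨ *-congˡ D-inv ⟨
        ((ℓ * ℓ) * W x y) * (W s t * i)
          ≈⟨ solve 4 (λ l a b c → (l :* a) :* (b :* c) := (l :* b) :* (a :* c)) refl (ℓ * ℓ) (W x y) (W s t) i ⟩
        ((ℓ * ℓ) * W s t) * (W x y * i) ∎)

-- Vector arithmetic in K³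

module VectorAlgebra (R : CommutativeRing 0ℓ 0ℓ) (q : ℕ) where
  open CommutativeRing R hiding (zero; Carrier; _≈_; _+_; _*_; 0#; 1#)
  open Geometry R q
  open RingSolver R

  V-setoid : Setoid 0ℓ 0ℓ
  V-setoid = ×-setoid setoid (×-setoid setoid setoid)

  module ≈v = Setoid V-setoid

  +v-cong : ∀ {u u′ v v′} → u ≈v u′ → v ≈v v′ → (u +v v) ≈v (u′ +v v′)
  +v-cong (a , b , c) (a′ , b′ , c′) = +-cong a a′ , +-cong b b′ , +-cong c c′

  ·v-cong : ∀ {a b u v} → a ≈ b → u ≈v v → (a ·v u) ≈v (b ·v v)
  ·v-cong k (a , b , c) = *-cong k a , *-cong k b , *-cong k c

  ·v-congˡ : ∀ {a u v} → u ≈v v → (a ·v u) ≈v (a ·v v)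
  ·v-congˡ = ·v-cong refl

  +v-identityʳ : ∀ v → (v +v 0v) ≈v v
  +v-identityʳ v = +-identityʳ _ , +-identityʳ _ , +-identityʳ _

  ·v-zeroˡ : ∀ v → (0# ·v v) ≈v 0v
  ·v-zeroˡ v = zeroˡ _ , zeroˡ _ , zeroˡ _

  ·v-zeroʳ : ∀ a → (a ·v 0v) ≈v 0v
  ·v-zeroʳ a = zeroʳ _ , zeroʳ _ , zeroʳ _

  ·v-identityˡ : ∀ v → (1# ·v v) ≈v v
  ·v-identityˡ v = *-identityˡ _ , *-identityˡ _ , *-identityˡ _

  ·v-assoc : ∀ a b v → (a ·v (b ·v v)) ≈v ((a * b) ·v v)
  ·v-assoc a b v = sym (*-assoc _ _ _) , sym (*-assoc _ _ _) , sym (*-assoc _ _ _)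

  ·v-distribˡ : ∀ a u v → (a ·v (u +v v)) ≈v ((a ·v u) +v (a ·v v))
  ·v-distribˡ a u v = distribˡ _ _ _ , distribˡ _ _ _ , distribˡ _ _ _

  -- Written through the scalar -1, so that closure under sums and F_q-multiples covers differences.
  _-v_ : V → V → V
  u -v v = u +v ((- 1#) ·v v)

  -v-cong : ∀ {u u′ v v′} → u ≈v u′ → v ≈v v′ → (u -v v) ≈v (u′ -v v′)
  -v-cong u≈ v≈ = +v-cong u≈ (·v-congˡ v≈)

  u+[v-u] : ∀ u v → (u +v (v -v u)) ≈v v
  u+[v-u] (x , y , z) (x′ , y′ , z′) = law x x′ , law y y′ , law z z′
    where
    law : ∀ x y → x + (y + (- 1#) * x) ≈ y
    law = solve 2 (λ x y → x :+ (y :+ (:- :1) :* x) := y) refl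

  [u+v]-u : ∀ u v → ((u +v v) -v u) ≈v v
  [u+v]-u (x , y , z) (x′ , y′ , z′) = law x x′ , law y y′ , law z z′
    where
    law : ∀ x y → (x + y) + (- 1#) * x ≈ y
    law = solve 2 (λ x y → (x :+ y) :+ (:- :1) :* x := y) refl

  u-v≈0⇒u≈v : ∀ {u v} → (u -v v) ≈v 0v → u ≈v v
  u-v≈0⇒u≈v {u} {v} eq = ≈v.trans (≈v.sym (u+[v-u] v u)) (≈v.trans (+v-cong ≈v.refl eq) (+v-identityʳ v))

  u≈v⇒u-v≈0 : ∀ {u v} → u ≈v v → (u -v v) ≈v 0v
  u≈v⇒u-v≈0 {u} {v} eq = ≈v.trans (-v-cong (≈v.trans eq (≈v.sym (+v-identityʳ v))) ≈v.refl) ([u+v]-u v 0v)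

module FiniteVectors (R : CommutativeRing 0ℓ 0ℓ) (q : ℕ)
    (K-enum : Enum (CommutativeRing._≈_ R) (λ _ → ⊤) (q ℕ.^ 3)) where
  open Geometry R q
  open VectorAlgebra R q
  module K = Enumerations (CommutativeRing.isEquivalence R)
  module E = Enumerations ≈v.isEquivalence

  abstract
    _≟_ : ∀ x y → Dec (x ≈ y)
    _≟_ = K.Enum-≟ K-enum

    V-enum : Enum _≈v_ (λ _ → ⊤) (q ℕ.^ 3 ℕ.* (q ℕ.^ 3 ℕ.* q ℕ.^ 3))
    V-enum = E.Enum-cong (λ _ _ → tt) (λ _ _ → tt , tt , tt) (Enum-× K-enum (Enum-× K-enum K-enum))

    _≟v_ : ∀ u v → Dec (u ≈v v)
    _≟v_ = E.Enum-≟ V-enum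

-- Linear algebra over the finite subfield

record IsSubfield (R : CommutativeRing 0ℓ 0ℓ) (F : CommutativeRing.Carrier R → Set) : Set where
  open CommutativeRing R
  field
    F-resp : ∀ {x y} → x ≈ y → F x → F y
    F-0 : F 0#
    F-1 : F 1#
    F-+ : ∀ {x y} → F x → F y → F (x + y)
    F-* : ∀ {x y} → F x → F y → F (x * y)
    F-neg : ∀ {x} → F x → F (- x)
    F-inv : ∀ {x y} → x * y ≈ 1# → F x → F y

module LinearAlgebra (R : CommutativeRing 0ℓ 0ℓ) (isField : IsField R) (q : ℕ)
    (K-enum : Enum (CommutativeRing._≈_ R) (λ _ → ⊤) (q ℕ.^ 3))
    (isSubfield : IsSubfield R (Geometry.InF R q))
    (F-enum : Enum (CommutativeRing._≈_ R) (Geometry.InF R q) q) where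
  open CommutativeRing R hiding (zero; Carrier; _≈_; _+_; _*_; 0#; 1#)
  open Geometry R q
  open IsField isField
  open FieldProperties R isField
  open IsSubfield isSubfield
  open VectorAlgebra R q
  open RingSolver R
  open FiniteVectors R q K-enum public

  record IsFSubspace (S : Sub) : Set where
    field
      ∈-resp : ∀ {u v} → u ≈v v → S u → S v
      ∈-0 : S 0v
      ∈-+ : ∀ {u v} → S u → S v → S (u +v v)
      ∈-· : ∀ {a v} → InF a → S v → S (a ·v v)

    ∈-minus : ∀ {u v} → S u → S v → S (u -v v)
    ∈-minus Su Sv = ∈-+ Su (∈-· (F-neg F-1) Sv)

    ∈-+-cancel : ∀ {u v} → S u → S (u +v v) → S v
    ∈-+-cancel {u} {v} Su Suv = ∈-resp ([u+v]-u u v) (∈-minus Suv Su)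

    ∈-·-cancel : ∀ {a v} → InF a → ¬ a ≈ 0# → S (a ·v v) → S v
    ∈-·-cancel {a} {v} Fa a≉0 Sav with inverse a a≉0
    ... | i , ai≈1 = ∈-resp
      (≈v.trans (·v-assoc i a v) (≈v.trans (·v-cong (trans (*-comm i a) ai≈1) ≈v.refl) (·v-identityˡ v)))
      (∈-· (F-inv ai≈1 Fa) Sav)

  open IsFSubspace

  FComb-resp : ∀ {vs x y} → x ≈v y → FComb vs x → FComb vs y
  FComb-resp x≈y (nil x≈0) = nil (≈v.trans (≈v.sym x≈y) x≈0)
  FComb-resp x≈y (cons a z Fa comb eq) = cons a z Fa comb (≈v.trans (≈v.sym x≈y) eq)

  FComb-weaken : ∀ {v vs x} → FComb vs x → FComb (v ∷ vs) x
  FComb-weaken {v} {vs} {x} comb = cons 0# x F-0 comb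
    (≈v.sym (≈v.trans (+v-cong (·v-zeroˡ v) ≈v.refl) (+-identityˡ _ , +-identityˡ _ , +-identityˡ _)))

  FComb-0 : ∀ vs → FComb vs 0v
  FComb-0 [] = nil ≈v.refl
  FComb-0 (v ∷ vs) = FComb-weaken (FComb-0 vs)

  FComb-head : ∀ v vs → FComb (v ∷ vs) v
  FComb-head v vs = cons 1# 0v F-1 (FComb-0 vs)
    (≈v.sym (≈v.trans (+v-identityʳ _) (·v-identityˡ v)))

  FComb-+ : ∀ {vs x y} → FComb vs x → FComb vs y → FComb vs (x +v y)
  FComb-+ (nil x≈0) (nil y≈0) = nil (≈v.trans (+v-cong x≈0 y≈0) (+v-identityʳ 0v))
  FComb-+ {v ∷ _} (cons a x′ Fa comb x≈) (cons b y′ Fb comb′ y≈) =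
    cons (a + b) (x′ +v y′) (F-+ Fa Fb) (FComb-+ comb comb′)
      (≈v.trans (+v-cong x≈ y≈) (law _ _ _ , law _ _ _ , law _ _ _))
    where
    law : ∀ v x y → (a * v + x) + (b * v + y) ≈ (a + b) * v + (x + y)
    law = solve 5 (λ a b v x y → (a :* v :+ x) :+ (b :* v :+ y) := (a :+ b) :* v :+ (x :+ y)) refl a b

  FComb-· : ∀ {vs a x} → InF a → FComb vs x → FComb vs (a ·v x)
  FComb-· {a = a} Fa (nil x≈0) = nil (≈v.trans (·v-congˡ x≈0) (·v-zeroʳ a))
  FComb-· {a = a} Fa (cons {v} b y Fb comb x≈) =
    cons (a * b) (a ·v y) (F-* Fa Fb) (FComb-· Fa comb)
      (≈v.trans (·v-congˡ x≈) (≈v.trans (·v-distribˡ a _ y) (+v-cong (·v-assoc a b v) ≈v.refl)))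

  FComb-isFSubspace : ∀ vs → IsFSubspace (FComb vs)
  FComb-isFSubspace vs = record
    { ∈-resp = FComb-resp ; ∈-0 = FComb-0 vs ; ∈-+ = FComb-+ ; ∈-· = FComb-· }

  FComb-least : ∀ {S vs} → IsFSubspace S → All S vs → FComb vs ⊆ S
  FComb-least sub [] x (nil x≈0) = ∈-resp sub (≈v.sym x≈0) (∈-0 sub)
  FComb-least sub (Sv ∷ Svs) x (cons a y Fa comb x≈) =
    ∈-resp sub (≈v.sym x≈) (∈-+ sub (∈-· sub Fa Sv) (FComb-least sub Svs y comb))

  abstract
    -- The coefficient of the first vector is searched among the q elements of F_q; subtracting that
    -- multiple leaves a shorter list.
    FComb? : ∀ vs x → Dec (FComb vs x)
    FComb? [] x = Dec.map′ nil (λ { (nil x≈0) → x≈0 }) (x ≟v 0v)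
    FComb? (v ∷ vs) x = Dec.map′
      (λ (a , Fa , comb) → cons a _ Fa comb (≈v.sym (u+[v-u] (a ·v v) x)))
      (λ { (cons a y Fa comb x≈) → a , Fa , FComb-resp
           (≈v.trans (≈v.sym ([u+v]-u (a ·v v) y)) (-v-cong (≈v.sym x≈) ≈v.refl)) comb })
      (K.Enum-∃? F-enum (λ a → FComb? vs (x -v (a ·v v)))
        (λ a≈b → FComb-resp (-v-cong ≈v.refl (·v-cong a≈b ≈v.refl))))

    -- Coordinates are unique: two different coefficients a and b of v would put (a - b) v, and
    -- hence v, into the span of the other vectors.
    FComb-enum : ∀ vs → FIndep vs → Enum _≈v_ (FComb vs) (q ℕ.^ length vs)
    FComb-enum [] _ = record
      { to = λ _ → 0v
      ; to-inj = λ { Fin.zero Fin.zero _ → ≡.refl }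
      ; to-in = λ _ → nil ≈v.refl
      ; index = λ { x (nil x≈0) → Fin.zero , ≈v.sym x≈0 } }
      where import Data.Fin as Fin
    FComb-enum (v ∷ vs) (v∉ , indep) = E.Enum-cong
      (λ { x ((a , y) , (Fa , comb) , eq) → cons a y Fa comb (≈v.sym eq) })
      (λ { x (cons a y Fa comb eq) → (a , y) , (Fa , comb) , ≈v.sym eq })
      (Images.Enum-image ≈v.isEquivalence h h-cong h-inj (Enum-× F-enum (FComb-enum vs indep)))
      where
      h : Carrier × V → V
      h (a , y) = (a ·v v) +v y

      h-cong : ∀ {p r} → Pointwise _≈_ _≈v_ p r → h p ≈v h r
      h-cong (a≈ , y≈) = +v-cong (·v-cong a≈ ≈v.refl) y≈

      h-inj : ∀ {p r} → InF (proj₁ p) × FComb vs (proj₂ p) → InF (proj₁ r) × FComb vs (proj₂ r) →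
        h p ≈v h r → Pointwise _≈_ _≈v_ p r
      h-inj {a , y} {b , z} (Fa , comb-y) (Fb , comb-z) eq@(eq₁ , eq₂ , eq₃) with a ≟ b
      ... | yes a≈b = a≈b , ≈v.trans (≈v.sym ([u+v]-u (a ·v v) y))
        (≈v.trans (-v-cong eq (·v-cong a≈b ≈v.refl)) ([u+v]-u (b ·v v) z))
      ... | no a≉b = contradiction
        (∈-·-cancel (FComb-isFSubspace vs) (F-+ Fa (F-neg Fb)) (x-y≉0 a≉b)
          (FComb-resp (law eq₁ , law eq₂ , law eq₃) (∈-minus (FComb-isFSubspace vs) comb-z comb-y)))
        v∉
        where
        law : ∀ {v y z} → a * v + y ≈ b * v + z → z + (- 1#) * y ≈ (a - b) * v
        law {v} {y} {z} eq = sym (trans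
          (solve 5 (λ a b v y z → (a :- b) :* v := (z :+ (:- :1) :* y) :+ :1 :* ((a :* v :+ y) :- (b :* v :+ z))) refl a b v y z)
          (x+y*0 (x≈y⇒x-y≈0 eq)))

  module _ {d S} (S-space : IsSpace d S) where
    private
      bs = proj₁ S-space
      indep = proj₁ (proj₂ (proj₂ S-space))

    space⇒comb : S ⊆ FComb bs
    space⇒comb x = proj₁ (proj₂ (proj₂ (proj₂ S-space)) x)

    comb⇒space : FComb bs ⊆ S
    comb⇒space x = proj₂ (proj₂ (proj₂ (proj₂ S-space)) x)

    space-isFSubspace : IsFSubspace S
    space-isFSubspace = record
      { ∈-resp = λ u≈v Su → comb⇒space _ (FComb-resp u≈v (space⇒comb _ Su))
      ; ∈-0 = comb⇒space _ (FComb-0 bs)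
      ; ∈-+ = λ Su Sv → comb⇒space _ (FComb-+ (space⇒comb _ Su) (space⇒comb _ Sv))
      ; ∈-· = λ Fa Su → comb⇒space _ (FComb-· Fa (space⇒comb _ Su)) }

    space-∈? : ∀ x → Dec (S x)
    space-∈? x = Dec.map′ (comb⇒space x) (space⇒comb x) (FComb? bs x)

    space-enum : Enum _≈v_ S (q ℕ.^ suc d)
    space-enum = ≡.subst (λ k → Enum _≈v_ S (q ℕ.^ k)) (proj₁ (proj₂ S-space))
      (E.Enum-cong comb⇒space space⇒comb (FComb-enum bs indep))

    abstract
      -- Otherwise the q^9 vectors of V would fit into the q^(d+1) vectors of S.
      space-proper : 1 ℕ.< q → d ℕ.< 8 → ∃ λ u → ¬ S u
      space-proper 1<q d<8 with ¬∀⟶∃¬ _ (S ∘ to V-enum) (space-∈? ∘ to V-enum) not-all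
        where
        sizes : q ℕ.^ 3 ℕ.* (q ℕ.^ 3 ℕ.* q ℕ.^ 3) ≡ q ℕ.^ 9
        sizes = ≡.sym (≡.trans (ℕ.^-distribˡ-+-* q 3 6) (cong (q ℕ.^ 3 ℕ.*_) (ℕ.^-distribˡ-+-* q 3 3)))
        not-all : ¬ (∀ i → S (to V-enum i))
        not-all all = ℕ.<⇒≱ (ℕ.^-monoʳ-< q 1<q (ℕ.s≤s d<8))
          (≡.subst (ℕ._≤ q ℕ.^ suc d) sizes
            (E.Enum-⊆⇒≤ V-enum space-enum (λ x _ → ∈-resp space-isFSubspace (proj₂ (index V-enum x tt)) (all _))))
      ... | i , ∉S = to V-enum i , ∉S

    space-extend : ∀ {u} → ¬ S u → IsSpace (suc d) (FComb (u ∷ bs))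
    space-extend {u} u∉S = u ∷ bs , cong suc (proj₁ (proj₂ S-space)) , (u∉S ∘ comb⇒space u , indep) ,
      λ x → (λ comb → comb) , (λ comb → comb)

    extend-⊇ : ∀ u → S ⊆ FComb (u ∷ bs)
    extend-⊇ u x Sx = FComb-weaken (space⇒comb x Sx)

    extend-∈ : ∀ {u x} → FComb (u ∷ bs) x → ∃ λ a → InF a × S (x -v (a ·v u))
    extend-∈ {u} (cons a y Fa comb x≈) = a , Fa , ∈-resp space-isFSubspace
      (≈v.trans (≈v.sym ([u+v]-u (a ·v u) y)) (-v-cong (≈v.sym x≈) ≈v.refl)) (comb⇒space y comb)

  abstract
    -- Both spaces have q^(d+1) vectors, so the inclusion cannot be strict.
    same-dimension-⊆⇒⊇ : ∀ {d S T} → IsSpace d S → IsSpace d T → S ⊆ T → T ⊆ S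
    same-dimension-⊆⇒⊇ S-space T-space S⊆T x Tx
      with E.Enum-⊆⇒⊇ (space-enum S-space) (space-enum T-space) S⊆T x Tx
    ... | y , Sy , y≈x = ∈-resp (space-isFSubspace S-space) y≈x Sy

-- The operators σ - ℓ and σ² + ℓ σ + ℓ²

module FLinearMap (R : CommutativeRing 0ℓ 0ℓ) (isField : IsField R) (q : ℕ)
    (K-enum : Enum (CommutativeRing._≈_ R) (λ _ → ⊤) (q ℕ.^ 3))
    (isSubfield : IsSubfield R (Geometry.InF R q))
    (F-enum : Enum (CommutativeRing._≈_ R) (Geometry.InF R q) q)
    (1<q : 1 ℕ.< q)
    (σ : Geometry.V R q → Geometry.V R q) (e₁ e₂ e₃ : Geometry.V R q)
    (setting : Geometry.Setting R q σ e₁ e₂ e₃) where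
  open CommutativeRing R hiding (zero; Carrier; _≈_; _+_; _*_; 0#; 1#)
  open Geometry R q
  open WithMaps σ e₁ e₂ e₃
  open Setting setting
  open IsField isField
  open FieldProperties R isField
  open IsSubfield isSubfield
  open VectorAlgebra R q
  open RingSolver R
  open LinearAlgebra R isField q K-enum isSubfield F-enum
  open IsFSubspace
  open SetoidReasoning V-setoid

  c : Carrier
  c = proj₁ σ³-id

  Fc : InF c
  Fc = proj₁ (proj₂ σ³-id)

  c≉0 : ¬ c ≈ 0#
  c≉0 = proj₁ (proj₂ (proj₂ σ³-id))

  σ³≈c : ∀ x → σ³ x ≈v (c ·v x)
  σ³≈c = proj₂ (proj₂ (proj₂ σ³-id))

  σ-≈ : ∀ {x y} → x ≈v y → σ x ≈v σ y
  σ-≈ = σ-cong _ _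

  σ-0 : σ 0v ≈v 0v
  σ-0 = ≈v.trans (σ-≈ (≈v.sym (·v-zeroˡ 0v))) (≈v.trans (σ-Flin 0# 0v F-0) (·v-zeroˡ (σ 0v)))

  σ-combination : ∀ {a b} x y → InF a → InF b → σ ((a ·v x) +v (b ·v y)) ≈v ((a ·v σ x) +v (b ·v σ y))
  σ-combination x y Fa Fb = ≈v.trans (σ-add _ _) (+v-cong (σ-Flin _ x Fa) (σ-Flin _ y Fb))

  N : Carrier → V → V
  N ℓ x = σ x -v (ℓ ·v x)

  -- the cofactor of σ − ℓ in σ³ − ℓ³
  T : Carrier → V → V
  T ℓ x = σ² x +v ((ℓ ·v σ x) +v ((ℓ * ℓ) ·v x))

  Kernel : Carrier → Sub
  Kernel ℓ x = T ℓ x ≈v 0v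

  N-cong : ∀ {ℓ ℓ′ x y} → ℓ ≈ ℓ′ → x ≈v y → N ℓ x ≈v N ℓ′ y
  N-cong ℓ≈ x≈ = -v-cong (σ-≈ x≈) (·v-cong ℓ≈ x≈)

  N-+ : ∀ ℓ x y → N ℓ (x +v y) ≈v (N ℓ x +v N ℓ y)
  N-+ ℓ x y = ≈v.trans (+v-cong (σ-add x y) ≈v.refl) (law _ _ _ _ , law _ _ _ _ , law _ _ _ _)
    where
    law : ∀ sx sy x y → (sx + sy) + (- 1#) * (ℓ * (x + y)) ≈ (sx + (- 1#) * (ℓ * x)) + (sy + (- 1#) * (ℓ * y))
    law = solve 5 (λ l sx sy x y → (sx :+ sy) :+ (:- :1) :* (l :* (x :+ y)) :=
      (sx :+ (:- :1) :* (l :* x)) :+ (sy :+ (:- :1) :* (l :* y))) refl ℓ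

  σ-T : ∀ {ℓ} x → InF ℓ → σ (T ℓ x) ≈v T ℓ (σ x)
  σ-T {ℓ} x Fℓ = ≈v.trans (σ-add _ _) (+v-cong ≈v.refl (σ-combination (σ x) x Fℓ (F-* Fℓ Fℓ)))

  -- Kept general in ℓ: for ℓ³ = c it puts the image of σ - ℓ into the kernel, while for the scalar
  -- induced modulo a hwise-fixed space it is what proves ℓ³ = c.
  NT : ∀ {ℓ} x → InF ℓ → N ℓ (T ℓ x) ≈v ((c - ℓ * (ℓ * ℓ)) ·v x)
  NT {ℓ} x Fℓ = ≈v.trans
    (+v-cong (≈v.trans (σ-T x Fℓ) (+v-cong (σ³≈c x) ≈v.refl)) ≈v.refl)
    (law _ _ _ , law _ _ _ , law _ _ _)
    where
    law : ∀ x sx ssx → (c * x + (ℓ * ssx + (ℓ * ℓ) * sx)) + (- 1#) * (ℓ * (ssx + (ℓ * sx + (ℓ * ℓ) * x)))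
      ≈ (c - ℓ * (ℓ * ℓ)) * x
    law = solve 5 (λ c l x sx ssx →
      (c :* x :+ (l :* ssx :+ (l :* l) :* sx)) :+ (:- :1) :* (l :* (ssx :+ (l :* sx :+ (l :* l) :* x)))
        := (c :- l :* (l :* l)) :* x) refl c ℓ

  T-cong : ∀ {ℓ ℓ′ x y} → ℓ ≈ ℓ′ → x ≈v y → T ℓ x ≈v T ℓ′ y
  T-cong ℓ≈ x≈ = +v-cong (σ-≈ (σ-≈ x≈)) (+v-cong (·v-cong ℓ≈ (σ-≈ x≈)) (·v-cong (*-cong ℓ≈ ℓ≈) x≈))

  T-+ : ∀ ℓ x y → T ℓ (x +v y) ≈v (T ℓ x +v T ℓ y)
  T-+ ℓ x y = ≈v.trans
    (+v-cong (≈v.trans (σ-≈ (σ-add x y)) (σ-add _ _)) (+v-cong (·v-congˡ (σ-add x y)) ≈v.refl))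
    (law _ _ _ _ _ _ , law _ _ _ _ _ _ , law _ _ _ _ _ _)
    where
    law : ∀ x y sx sy ssx ssy → (ssx + ssy) + (ℓ * (sx + sy) + (ℓ * ℓ) * (x + y)) ≈
      (ssx + (ℓ * sx + (ℓ * ℓ) * x)) + (ssy + (ℓ * sy + (ℓ * ℓ) * y))
    law = solve 7 (λ l x y sx sy ssx ssy → (ssx :+ ssy) :+ (l :* (sx :+ sy) :+ (l :* l) :* (x :+ y)) :=
      (ssx :+ (l :* sx :+ (l :* l) :* x)) :+ (ssy :+ (l :* sy :+ (l :* l) :* y))) refl ℓ

  T-· : ∀ ℓ {a} x → InF a → T ℓ (a ·v x) ≈v (a ·v T ℓ x)
  T-· ℓ {a} x Fa = ≈v.trans
    (+v-cong (≈v.trans (σ-≈ (σ-Flin a x Fa)) (σ-Flin a _ Fa)) (+v-cong (·v-congˡ (σ-Flin a x Fa)) ≈v.refl))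
    (law _ _ _ , law _ _ _ , law _ _ _)
    where
    law : ∀ x sx ssx → a * ssx + (ℓ * (a * sx) + (ℓ * ℓ) * (a * x)) ≈ a * (ssx + (ℓ * sx + (ℓ * ℓ) * x))
    law = solve 5 (λ l a x sx ssx → a :* ssx :+ (l :* (a :* sx) :+ (l :* l) :* (a :* x)) :=
      a :* (ssx :+ (l :* sx :+ (l :* l) :* x))) refl ℓ a

  Kernel-isFSubspace : ∀ ℓ → IsFSubspace (Kernel ℓ)
  Kernel-isFSubspace ℓ = record
    { ∈-resp = λ u≈v Tu → ≈v.trans (T-cong refl (≈v.sym u≈v)) Tu
    ; ∈-0 = ≈v.trans (T-cong refl (≈v.sym (·v-zeroˡ 0v)))
        (≈v.trans (T-· ℓ 0v F-0) (·v-zeroˡ _))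
    ; ∈-+ = λ Tu Tv → ≈v.trans (T-+ ℓ _ _) (≈v.trans (+v-cong Tu Tv) (+v-identityʳ 0v))
    ; ∈-· = λ Fa Tv → ≈v.trans (T-· ℓ _ Fa) (≈v.trans (·v-congˡ Tv) (·v-zeroʳ _)) }

  Kernel-σ : ∀ {ℓ x} → InF ℓ → Kernel ℓ x → Kernel ℓ (σ x)
  Kernel-σ Fℓ Tx = ≈v.trans (≈v.sym (σ-T _ Fℓ)) (≈v.trans (σ-≈ Tx) σ-0)

  TN≈NT : ∀ {ℓ} x → InF ℓ → T ℓ (N ℓ x) ≈v N ℓ (T ℓ x)
  TN≈NT {ℓ} x Fℓ = begin
    T ℓ (σ x -v (ℓ ·v x))              ≈⟨ T-+ ℓ _ _ ⟩
    T ℓ (σ x) +v T ℓ ((- 1#) ·v (ℓ ·v x))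
      ≈⟨ +v-cong (≈v.sym (σ-T x Fℓ)) (≈v.trans (T-· ℓ _ (F-neg F-1)) (·v-congˡ (T-· ℓ x Fℓ))) ⟩
    N ℓ (T ℓ x) ∎

  record IsEigenvalue (ℓ : Carrier) : Set where
    field
      Fℓ : InF ℓ
      ℓ³≈c : ℓ * (ℓ * ℓ) ≈ c

  open IsEigenvalue

  N∈Kernel : ∀ {ℓ} → IsEigenvalue ℓ → ∀ x → Kernel ℓ (N ℓ x)
  N∈Kernel {ℓ} eig x = begin
    T ℓ (N ℓ x)                      ≈⟨ TN≈NT x (Fℓ eig) ⟩
    N ℓ (T ℓ x)                      ≈⟨ NT x (Fℓ eig) ⟩
    (c - ℓ * (ℓ * ℓ)) ·v x           ≈⟨ ·v-cong (x≈y⇒x-y≈0 (sym (ℓ³≈c eig))) ≈v.refl ⟩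
    0# ·v x                          ≈⟨ ·v-zeroˡ x ⟩
    0v ∎

  -- As σ³ = c, the map c⁻¹ σ² inverts σ, and it preserves every invariant subspace.
  σ-invariant⇒Fixed : ∀ {S} → IsFSubspace S → (∀ x → S x → S (σ x)) → Fixed S
  σ-invariant⇒Fixed {S} sub inv = inv , λ x Sx → i ·v σ² x , ∈-· sub Fi (inv _ (inv _ Sx)) ,
      (begin
        σ (i ·v σ² x)    ≈⟨ σ-Flin i _ Fi ⟩
        i ·v σ³ x        ≈⟨ ·v-congˡ (σ³≈c x) ⟩
        i ·v (c ·v x)    ≈⟨ ·v-assoc i c x ⟩
        (i * c) ·v x     ≈⟨ ·v-cong (trans (*-comm i c) ci≈1) ≈v.refl ⟩
        1# ·v x          ≈⟨ ·v-identityˡ x ⟩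
        x ∎)
    where
    i : Carrier
    i = proj₁ (inverse c c≉0)
    ci≈1 : c * i ≈ 1#
    ci≈1 = proj₂ (inverse c c≉0)
    Fi : InF i
    Fi = F-inv ci≈1 Fc

  -- Modulo the kernel σ is the scalar ℓ, so every subspace above the kernel is invariant, the
  -- 6-spaces among them.
  Kernel⊆⇒Fixed : ∀ {ℓ S} → IsEigenvalue ℓ → IsFSubspace S → Kernel ℓ ⊆ S → Fixed S
  Kernel⊆⇒Fixed {ℓ} eig sub Ker⊆S = σ-invariant⇒Fixed sub
    (λ x Sx → ∈-resp sub (u+[v-u] (ℓ ·v x) (σ x)) (∈-+ sub (∈-· sub (Fℓ eig) Sx) (Ker⊆S _ (N∈Kernel eig x))))

  -- The scalar induced by σ modulo a hwise-fixed 5-space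

  module HwiseFixed {Π : Sub} (hwise : HwiseFixed5Space Π) where
    private
      Π-space : IsSpace 5 Π
      Π-space = proj₁ hwise

      Π-sub : IsFSubspace Π
      Π-sub = space-isFSubspace Π-space

      abstract
        u₁ : V
        u₁ = proj₁ (space-proper Π-space 1<q (ℕ.m≤m+n 6 2))

        u₁∉Π : ¬ Π u₁
        u₁∉Π = proj₂ (space-proper Π-space 1<q (ℕ.m≤m+n 6 2))

        -- The 6-space spanned by u and Π is fixed, so σ u is a multiple of u modulo Π. The multiple
        -- may still depend on u.
        eigenvalue-of : ∀ {u} → ¬ Π u → ∃ λ ℓ → InF ℓ × Π (N ℓ u)
        eigenvalue-of {u} u∉Π = extend-∈ Π-space
          (proj₁ (proj₂ hwise _ (space-extend Π-space u∉Π) (extend-⊇ Π-space u)) u (FComb-head u _))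

    abstract
      ℓ : Carrier
      ℓ = proj₁ (eigenvalue-of u₁∉Π)

      private
        Fℓ′ : InF ℓ
        Fℓ′ = proj₁ (proj₂ (eigenvalue-of u₁∉Π))

        Nu₁∈Π : Π (N ℓ u₁)
        Nu₁∈Π = proj₂ (proj₂ (eigenvalue-of u₁∉Π))

    private
      Π₁ : Sub
      Π₁ = FComb (u₁ ∷ proj₁ Π-space)

      Π₁-space : IsSpace 6 Π₁
      Π₁-space = space-extend Π-space u₁∉Π

      Π₁-sub : IsFSubspace Π₁
      Π₁-sub = space-isFSubspace Π₁-space

      Π⊆Π₁ : Π ⊆ Π₁
      Π⊆Π₁ = extend-⊇ Π-space u₁

      u₁∈Π₁ : Π₁ u₁
      u₁∈Π₁ = FComb-head u₁ _

      -- u₁, v and u₁ + v are eigenvectors modulo Π, and u₁, v are independent modulo Π, so the eigenvalues agree.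
      N∈Π-outside : ∀ v → ¬ Π₁ v → Π (N ℓ v)
      N∈Π-outside v v∉Π₁ = ∈-resp Π-sub (N-cong (trans β≈γ (sym ℓ≈γ)) ≈v.refl) Nv∈Π
        where
        v-eigen : ∃ λ β → InF β × Π (N β v)
        v-eigen = eigenvalue-of (v∉Π₁ ∘ Π⊆Π₁ v)
        w-eigen : ∃ λ γ → InF γ × Π (N γ (u₁ +v v))
        w-eigen = eigenvalue-of (λ ∈Π → v∉Π₁ (∈-+-cancel Π₁-sub u₁∈Π₁ (Π⊆Π₁ _ ∈Π)))
        β γ : Carrier
        β = proj₁ v-eigen
        γ = proj₁ w-eigen
        Fβ : InF β
        Fβ = proj₁ (proj₂ v-eigen)
        Fγ : InF γ
        Fγ = proj₁ (proj₂ w-eigen)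
        Nv∈Π : Π (N β v)
        Nv∈Π = proj₂ (proj₂ v-eigen)
        Nw∈Π : Π (N γ (u₁ +v v))
        Nw∈Π = proj₂ (proj₂ w-eigen)
        combination : Π (((ℓ - γ) ·v u₁) +v ((β - γ) ·v v))
        combination = ∈-resp Π-sub
          (≈v.trans (-v-cong (+v-cong (σ-add u₁ v) ≈v.refl) ≈v.refl) (law _ _ _ _ , law _ _ _ _ , law _ _ _ _))
          (∈-minus Π-sub Nw∈Π (∈-+ Π-sub Nu₁∈Π Nv∈Π))
          where
          law : ∀ u v su sv → ((su + sv) + (- 1#) * (γ * (u + v))) +
            (- 1#) * ((su + (- 1#) * (ℓ * u)) + (sv + (- 1#) * (β * v))) ≈ (ℓ - γ) * u + (β - γ) * v
          law = solve 7 (λ l b g u v su sv → ((su :+ sv) :+ (:- :1) :* (g :* (u :+ v))) :+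
            (:- :1) :* ((su :+ (:- :1) :* (l :* u)) :+ (sv :+ (:- :1) :* (b :* v))) :=
            (l :- g) :* u :+ (b :- g) :* v) refl ℓ β γ
        β≈γ : β ≈ γ
        β≈γ = decidable-stable (β ≟ γ) λ β≉γ → v∉Π₁
          (∈-·-cancel Π₁-sub (F-+ Fβ (F-neg Fγ)) (x-y≉0 β≉γ)
            (∈-+-cancel Π₁-sub (∈-· Π₁-sub (F-+ Fℓ′ (F-neg Fγ)) u₁∈Π₁) (Π⊆Π₁ _ combination)))
        ℓ≈γ : ℓ ≈ γ
        ℓ≈γ = decidable-stable (ℓ ≟ γ) λ ℓ≉γ → u₁∉Π
          (∈-·-cancel Π-sub (F-+ Fℓ′ (F-neg Fγ)) (x-y≉0 ℓ≉γ)
            (∈-resp Π-sub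
              (≈v.trans (+v-cong ≈v.refl (≈v.trans (·v-cong (x≈y⇒x-y≈0 β≈γ) ≈v.refl) (·v-zeroˡ v))) (+v-identityʳ _))
              combination))

    abstract
      -- A vector v of Π₁ is the difference of u₂ + v and u₂, both outside Π₁ once u₂ is; such a u₂
      -- exists because a 6-space is proper.
      N∈Π : ∀ v → Π (N ℓ v)
      N∈Π v = [ inside , N∈Π-outside v ]′ (toSum (space-∈? Π₁-space v))
        where
        inside : Π₁ v → Π (N ℓ v)
        inside v∈Π₁ = ∈-+-cancel Π-sub (N∈Π-outside u₂ u₂∉Π₁) (∈-resp Π-sub (N-+ ℓ u₂ v)
          (N∈Π-outside (u₂ +v v) (λ ∈Π₁ → u₂∉Π₁ (∈-+-cancel Π₁-sub v∈Π₁
            (FComb-resp (+-comm _ _ , +-comm _ _ , +-comm _ _) ∈Π₁)))))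
          where
          u₂ : V
          u₂ = proj₁ (space-proper Π₁-space 1<q (ℕ.m≤m+n 7 1))
          u₂∉Π₁ : ¬ Π₁ u₂
          u₂∉Π₁ = proj₂ (space-proper Π₁-space 1<q (ℕ.m≤m+n 7 1))

      -- The vector (c - ℓ³) u₁ is a value of σ - ℓ and so lies in Π, whereas u₁ does not.
      isEigenvalue : IsEigenvalue ℓ
      isEigenvalue = record { Fℓ = Fℓ′ ; ℓ³≈c = ℓ³≈c′ }
        where
        ℓ³≈c′ : ℓ * (ℓ * ℓ) ≈ c
        ℓ³≈c′ = sym (decidable-stable (c ≟ (ℓ * (ℓ * ℓ))) λ c≉ℓ³ → u₁∉Π
          (∈-·-cancel Π-sub (F-+ Fc (F-neg (F-* Fℓ′ (F-* Fℓ′ Fℓ′)))) (x-y≉0 c≉ℓ³)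
            (∈-resp Π-sub (NT u₁ Fℓ′) (N∈Π (T ℓ u₁)))))

  -- Points whose σ-orbit spans a line

  FProp-sym : ∀ {u v} → ¬ v ≈v 0v → FProp u v → FProp v u
  FProp-sym {u} {v} v≉0 (a , Fa , v≈au) = i , F-inv ai≈1 Fa , (begin
    u              ≈⟨ ·v-identityˡ u ⟨
    1# ·v u        ≈⟨ ·v-cong (trans (sym ai≈1) (*-comm a i)) ≈v.refl ⟩
    (i * a) ·v u   ≈⟨ ·v-assoc i a u ⟨
    i ·v (a ·v u)  ≈⟨ ·v-congˡ v≈au ⟨
    i ·v v ∎)
    where
    a≉0 : ¬ a ≈ 0#
    a≉0 a≈0 = v≉0 (≈v.trans v≈au (≈v.trans (·v-cong a≈0 ≈v.refl) (·v-zeroˡ u)))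
    i : Carrier
    i = proj₁ (inverse a a≉0)
    ai≈1 : a * i ≈ 1#
    ai≈1 = proj₂ (inverse a a≉0)

  FComb-1⇒FProp : ∀ {u v} → FComb (u ∷ []) v → FProp u v
  FComb-1⇒FProp (cons a y Fa (nil y≈0) x≈) = a , Fa , ≈v.trans x≈ (≈v.trans (+v-cong ≈v.refl y≈0) (+v-identityʳ _))

  nil⁻¹ : ∀ {x} → FComb [] x → x ≈v 0v
  nil⁻¹ (nil x≈0) = x≈0

  FComb-1-cancel : ∀ {u a v} → InF a → ¬ FProp u v → FComb (u ∷ []) (a ·v v) → a ≈ 0#
  FComb-1-cancel {a = a} Fa v∉ comb = decidable-stable (a ≟ 0#) λ a≉0 →
    v∉ (FComb-1⇒FProp (∈-·-cancel (FComb-isFSubspace _) Fa a≉0 comb))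

  -- Shared by the I⋮- and II⋮-points, so that one argument serves both kinds.
  record IsDotPoint (w : V) : Set where
    field
      nonzero : ¬ w ≈v 0v
      not-fixed : ¬ FProp w (σ w)
      collinear : CollinearF w

    private
      not-fixed′ : ¬ FProp (σ w) w
      not-fixed′ = not-fixed ∘ FProp-sym nonzero

      σ-≈0 : ∀ {x} → σ x ≈v 0v → x ≈v 0v
      σ-≈0 eq = σ-inj _ _ (≈v.trans eq (≈v.sym σ-0))

      σw∉⟨σ²w⟩ : ¬ FProp (σ² w) (σ w)
      σw∉⟨σ²w⟩ (a , Fa , eq) = not-fixed′ (a , Fa , σ-inj _ _ (≈v.trans eq (≈v.sym (σ-Flin a _ Fa))))

      -- `CollinearF` negates a conjunction; the parts about σ w and σ² w hold because σ is
      -- injective and w is not fixed, so the part about w must fail.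
      w-dependent : FComb (σ w ∷ σ² w ∷ []) w
      w-dependent = decidable-stable (FComb? (σ w ∷ σ² w ∷ []) w) λ w∉ →
        collinear (w∉ , σw∉⟨σ²w⟩ ∘ FComb-1⇒FProp , nonzero ∘ σ-≈0 ∘ σ-≈0 ∘ nil⁻¹ , tt)

      -- The coefficient of σ² w is nonzero, as otherwise w would be a multiple of σ w; so the
      -- relation can be solved for σ² w.
      isolate : FComb (σ w ∷ σ² w ∷ []) w → FComb (σ w ∷ w ∷ []) (σ² w)
      isolate (cons a y Fa (cons b z Fb (nil z≈0) y≈) w≈) =
        ∈-·-cancel sub Fb b≉0 (∈-+-cancel sub (∈-· sub Fa (FComb-head _ _))
          (∈-resp sub (≈v.trans w≈ (+v-cong ≈v.refl y≈′)) (FComb-weaken (FComb-head _ _))))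
        where
        sub : IsFSubspace (FComb (σ w ∷ w ∷ []))
        sub = FComb-isFSubspace _
        y≈′ : y ≈v (b ·v σ² w)
        y≈′ = ≈v.trans y≈ (≈v.trans (+v-cong ≈v.refl z≈0) (+v-identityʳ _))
        b≉0 : ¬ b ≈ 0#
        b≉0 b≈0 = not-fixed′ (a , Fa , ≈v.trans w≈ (≈v.trans
          (+v-cong ≈v.refl (≈v.trans y≈′ (≈v.trans (·v-cong b≈0 ≈v.refl) (·v-zeroˡ _)))) (+v-identityʳ _)))

    -- Writing σ²w = a σw + b w and applying σ gives c w = (a² + b) σw + a b w; as w is not an eigenvector,
    -- b = −a² and a b = c, so ℓ = −a is an eigenvalue.
    eigenvalue : ∃ λ ℓ → IsEigenvalue ℓ × Kernel ℓ w
    eigenvalue = from-relation (isolate w-dependent)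
      where
      from-relation : FComb (σ w ∷ w ∷ []) (σ² w) → ∃ λ ℓ → IsEigenvalue ℓ × Kernel ℓ w
      from-relation (cons a y Fa (cons b z Fb (nil z≈0) y≈) σ²w≈′) =
        - a , record { Fℓ = F-neg Fa ; ℓ³≈c = -a³≈c } , in-kernel
        where
        σ²w≈ : σ² w ≈v ((a ·v σ w) +v (b ·v w))
        σ²w≈ = ≈v.trans σ²w≈′ (+v-cong ≈v.refl (≈v.trans y≈ (≈v.trans (+v-cong ≈v.refl z≈0) (+v-identityʳ _))))
        cw≈ : (c ·v w) ≈v ((a ·v ((a ·v σ w) +v (b ·v w))) +v (b ·v σ w))
        cw≈ = ≈v.trans (≈v.sym (σ³≈c w)) (≈v.trans (σ-≈ σ²w≈)
          (≈v.trans (σ-combination _ _ Fa Fb) (+v-cong (·v-congˡ σ²w≈) ≈v.refl)))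
        relation : ((a * a + b) ·v σ w) ≈v ((c - a * b) ·v w)
        relation = law (proj₁ cw≈) , law (proj₁ (proj₂ cw≈)) , law (proj₂ (proj₂ cw≈))
          where
          law : ∀ {x sx} → c * x ≈ a * (a * sx + b * x) + b * sx → (a * a + b) * sx ≈ (c - a * b) * x
          law {x} {sx} eq = sym (trans
            (solve 5 (λ a b c x sx → (c :- a :* b) :* x :=
              (a :* a :+ b) :* sx :+ :1 :* (c :* x :- (a :* (a :* sx :+ b :* x) :+ b :* sx))) refl a b c x sx)
            (x+y*0 (x≈y⇒x-y≈0 eq)))
        Fd : InF (c - a * b)
        Fd = F-+ Fc (F-neg (F-* Fa Fb))
        a²+b≈0 : a * a + b ≈ 0#
        a²+b≈0 = FComb-1-cancel (F-+ (F-* Fa Fa) Fb) not-fixed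
          (FComb-resp (≈v.sym relation) (FComb-· Fd (FComb-head w [])))
        c≈ab : c - a * b ≈ 0#
        c≈ab = decidable-stable ((c - a * b) ≟ 0#) λ d≉0 → nonzero (nil⁻¹
          (∈-·-cancel (FComb-isFSubspace []) Fd d≉0
            (nil (≈v.trans (≈v.sym relation) (≈v.trans (·v-cong a²+b≈0 ≈v.refl) (·v-zeroˡ _))))))
        -a³≈c : (- a) * ((- a) * (- a)) ≈ c
        -a³≈c = trans
          (solve 3 (λ a b c → (:- a) :* ((:- a) :* (:- a)) := (c :+ (:- a) :* (a :* a :+ b)) :+ (:- :1) :* (c :- a :* b)) refl a b c)
          (trans (x+y*0 c≈ab) (x+y*0 a²+b≈0))
        in-kernel : Kernel (- a) w
        in-kernel = ≈v.trans (+v-cong σ²w≈ ≈v.refl) (law _ _ , law _ _ , law _ _)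
          where
          law : ∀ x sx → (a * sx + b * x) + ((- a) * sx + ((- a) * (- a)) * x) ≈ 0#
          law x sx = trans
            (solve 4 (λ a b x sx → (a :* sx :+ b :* x) :+ ((:- a) :* sx :+ ((:- a) :* (:- a)) :* x) := :0 :+ x :* (a :* a :+ b)) refl a b x sx)
            (x+y*0 a²+b≈0)

  -- The two kernel equations differ by (ℓ - ℓ′)(σ w + (ℓ + ℓ′) w), so distinct scalars would make w
  -- an eigenvector for -(ℓ + ℓ′).
  eigenvalue-unique : ∀ {ℓ ℓ′ w} → InF ℓ → InF ℓ′ → ¬ FProp w (σ w) → Kernel ℓ w → Kernel ℓ′ w → ℓ ≈ ℓ′
  eigenvalue-unique {ℓ} {ℓ′} {w} Fℓ Fℓ′ not-fixed Tw T′w = decidable-stable (ℓ ≟ ℓ′) λ ℓ≉ℓ′ →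
    not-fixed (- (ℓ + ℓ′) , F-neg (F-+ Fℓ Fℓ′) ,
      (law ℓ≉ℓ′ (proj₁ eq) , law ℓ≉ℓ′ (proj₁ (proj₂ eq)) , law ℓ≉ℓ′ (proj₂ (proj₂ eq))))
    where
    eq : T ℓ w ≈v T ℓ′ w
    eq = ≈v.trans Tw (≈v.sym T′w)
    law : ∀ {x sx ssx} → ¬ ℓ ≈ ℓ′ → ssx + (ℓ * sx + (ℓ * ℓ) * x) ≈ ssx + (ℓ′ * sx + (ℓ′ * ℓ′) * x) → sx ≈ (- (ℓ + ℓ′)) * x
    law {x} {sx} {ssx} ℓ≉ℓ′ eq = *-cancel-≉0 (x-y≉0 ℓ≉ℓ′) (trans
      (solve 5 (λ l l′ x sx ssx → (l :- l′) :* sx := (l :- l′) :* ((:- (l :+ l′)) :* x) :+ :1 :*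
        ((ssx :+ (l :* sx :+ (l :* l) :* x)) :- (ssx :+ (l′ :* sx :+ (l′ :* l′) :* x)))) refl ℓ ℓ′ x sx ssx)
      (x+y*0 (x≈y⇒x-y≈0 eq)))

  -- The kernel of T ℓ is the image of σ − ℓ, of F-dimension 6.
  KernelBasis : Carrier → Set
  KernelBasis ℓ = Σ (List V) λ bs → length bs ≡ 6 × FIndep bs ×
    All (λ b → ∃ λ x → N ℓ x ≈v b) bs × (Kernel ℓ ⊆ FComb bs)

  module WithKernelBasis (kernel-basis : ∀ {ℓ} → IsEigenvalue ℓ → KernelBasis ℓ) where

    Kernel-space : ∀ {ℓ} → IsEigenvalue ℓ → IsSpace 5 (Kernel ℓ)
    Kernel-space {ℓ} eig = let (bs , len , indep , images , spanning) = kernel-basis eig in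
      bs , len , indep , λ x → spanning x ,
        FComb-least (Kernel-isFSubspace ℓ)
          (All.map (λ (x , Nx≈b) → ∈-resp (Kernel-isFSubspace ℓ) Nx≈b (N∈Kernel eig x)) images) x

    Kernel-hwise : ∀ {ℓ} → IsEigenvalue ℓ → HwiseFixed5Space (Kernel ℓ)
    Kernel-hwise eig = Kernel-space eig ,
      λ S S-space Ker⊆S → Kernel⊆⇒Fixed eig (space-isFSubspace S-space) Ker⊆S

    -- Π contains all values of σ - ℓ, and the kernel has a basis of such values; both spaces have
    -- q^6 vectors.
    hwise≐Kernel : ∀ {Π} (hwise : HwiseFixed5Space Π) → Π ≐ Kernel (HwiseFixed.ℓ hwise)
    hwise≐Kernel {Π} hwise = same-dimension-⊆⇒⊇ (Kernel-space isEigenvalue) (proj₁ hwise) Ker⊆Π , Ker⊆Π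
      where
      open HwiseFixed hwise
      Π-sub : IsFSubspace Π
      Π-sub = space-isFSubspace (proj₁ hwise)
      Ker⊆Π : Kernel ℓ ⊆ Π
      Ker⊆Π x x∈Ker = let (bs , len , indep , images , spanning) = kernel-basis isEigenvalue in
        FComb-least Π-sub (All.map (λ (y , Ny≈b) → ∈-resp Π-sub Ny≈b (N∈Π y)) images) x (spanning x x∈Ker)

    module _ {w} (dot : IsDotPoint w) where
      open IsDotPoint dot

      private
        ℓ : Carrier
        ℓ = proj₁ eigenvalue
        eig : IsEigenvalue ℓ
        eig = proj₁ (proj₂ eigenvalue)
        w∈Ker : Kernel ℓ w
        w∈Ker = proj₂ (proj₂ eigenvalue)

        w∈line : PointSub w w
        w∈line = 1# , F-1 , ≈v.sym (·v-identityˡ w)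

      -- Treats points and lines together: a hwise-fixed 5-space above X is a kernel containing w,
      -- and w determines its scalar.
      uniqueHwise-⊇ : ∀ X → X w → X ⊆ Kernel ℓ → UniqueHwise X
      uniqueHwise-⊇ X w∈X X⊆Ker = Kernel ℓ , (Kernel-hwise eig , X⊆Ker) , unique
        where
        unique : ∀ Π → HwiseFixed5Space Π → X ⊆ Π → Π ≐ Kernel ℓ
        unique Π hwise X⊆Π =
          (λ x Πx → ≈v.trans (T-cong (sym ℓ′≈ℓ) ≈v.refl) (Π⊆ x Πx)) ,
          (λ x Tx → ⊆Π x (≈v.trans (T-cong ℓ′≈ℓ ≈v.refl) Tx))
          where
          Π⊆ : Π ⊆ Kernel (HwiseFixed.ℓ hwise)
          Π⊆ = proj₁ (hwise≐Kernel hwise)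
          ⊆Π : Kernel (HwiseFixed.ℓ hwise) ⊆ Π
          ⊆Π = proj₂ (hwise≐Kernel hwise)
          ℓ′≈ℓ : HwiseFixed.ℓ hwise ≈ ℓ
          ℓ′≈ℓ = eigenvalue-unique (Fℓ (HwiseFixed.isEigenvalue hwise)) (Fℓ eig) not-fixed
            (Π⊆ w (X⊆Π w w∈X)) w∈Ker

      point-uniqueHwise : UniqueHwise (PointSub w)
      point-uniqueHwise = uniqueHwise-⊇ (PointSub w) w∈line
        λ { x (a , Fa , x≈) → ∈-resp sub (≈v.sym x≈) (∈-· sub Fa w∈Ker) }
        where
        sub : IsFSubspace (Kernel ℓ)
        sub = Kernel-isFSubspace ℓ

      line-uniqueHwise : ∀ L → IsSpace 1 L → Fixed L → L w → UniqueHwise L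
      line-uniqueHwise L L-space L-fixed w∈L = uniqueHwise-⊇ L w∈L
        λ x x∈L → FComb-least (Kernel-isFSubspace ℓ) (Kernel-σ (Fℓ eig) w∈Ker ∷ w∈Ker ∷ []) x
          (same-dimension-⊆⇒⊇ span-space L-space span⊆L x x∈L)
        where
        span-space : IsSpace 1 (FComb (σ w ∷ w ∷ []))
        span-space = σ w ∷ w ∷ [] , ≡.refl ,
          (not-fixed ∘ FComb-1⇒FProp , (λ { (nil eq) → nonzero eq }) , tt) , λ x → (λ comb → comb) , (λ comb → comb)
        span⊆L : FComb (σ w ∷ w ∷ []) ⊆ L
        span⊆L = FComb-least (space-isFSubspace L-space) (proj₁ L-fixed w w∈L ∷ w∈L ∷ [])

-- Coordinates from the fixed subplane and the companion automorphism

module SemilinearCoordinates (R : CommutativeRing 0ℓ 0ℓ) (isField : IsField R) (q : ℕ) (1<q : 1 ℕ.< q)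
    (K-enum : Enum (CommutativeRing._≈_ R) (λ _ → ⊤) (q ℕ.^ 3))
    (σ : Geometry.V R q → Geometry.V R q) (e₁ e₂ e₃ : Geometry.V R q)
    (setting : Geometry.Setting R q σ e₁ e₂ e₃) where
  open CommutativeRing R hiding (zero; Carrier; _≈_; _+_; _*_; 0#; 1#)
  open Geometry R q
  open WithMaps σ e₁ e₂ e₃
  open Setting setting
  open IsField isField
  open FieldProperties R isField
  open VectorAlgebra R q
  open FiniteVectors R q K-enum
  open RingSolver R

  KComb-resp : ∀ {vs x y} → x ≈v y → KComb vs x → KComb vs y
  KComb-resp x≈y (nil x≈0) = nil (≈v.trans (≈v.sym x≈y) x≈0)
  KComb-resp x≈y (cons a z comb eq) = cons a z comb (≈v.trans (≈v.sym x≈y) eq)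

  KComb-· : ∀ {vs} a {x} → KComb vs x → KComb vs (a ·v x)
  KComb-· a (nil x≈0) = nil (≈v.trans (·v-congˡ x≈0) (·v-zeroʳ a))
  KComb-· a (cons {v} b y comb x≈) = cons (a * b) (a ·v y) (KComb-· a comb)
    (≈v.trans (·v-congˡ x≈) (≈v.trans (·v-distribˡ a _ y) (+v-cong (·v-assoc a b v) ≈v.refl)))

  KComb-cons : ∀ a {v vs x} → KComb vs x → KComb (v ∷ vs) ((a ·v v) +v x)
  KComb-cons a comb = cons a _ comb ≈v.refl

  independent-coefficient : ∀ {u vs x v} → ¬ KComb vs u → KComb vs v → ((x ·v u) +v v) ≈v 0v → x ≈ 0#
  independent-coefficient {u} {vs} {x} {v} u∉ comb eq with x ≟ 0#
  ... | yes x≈0 = x≈0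
  ... | no x≉0 with inverse x x≉0
  ... | i , xi≈1 = contradiction
    (KComb-resp (law (proj₁ eq) , law (proj₁ (proj₂ eq)) , law (proj₂ (proj₂ eq))) (KComb-· (- i) comb)) u∉
    where
    law : ∀ {u v} → x * u + v ≈ 0# → (- i) * v ≈ u
    law {u} {v} eq = sym (trans
      (solve 4 (λ x i u v → u := ((:- i) :* v :+ i :* (x :* u :+ v)) :+ u :* (:1 :- x :* i)) refl x i u v)
      (trans (x+y*0 (x≈y⇒x-y≈0 (sym xi≈1))) (x+y*0 eq)))

  Emb : V → V
  Emb (x , y , z) = (x ·v e₁) +v ((y ·v e₂) +v (z ·v e₃))

  Emb-cong : ∀ {k l} → k ≈v l → Emb k ≈v Emb l
  Emb-cong (x≈ , y≈ , z≈) = +v-cong (·v-cong x≈ ≈v.refl) (+v-cong (·v-cong y≈ ≈v.refl) (·v-cong z≈ ≈v.refl))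

  Emb-+ : ∀ k l → Emb (k +v l) ≈v (Emb k +v Emb l)
  Emb-+ (x , y , z) (x′ , y′ , z′) = law _ _ _ , law _ _ _ , law _ _ _
    where
    law : ∀ a b c → (x + x′) * a + ((y + y′) * b + (z + z′) * c) ≈ (x * a + (y * b + z * c)) + (x′ * a + (y′ * b + z′ * c))
    law = solve 9 (λ x y z x′ y′ z′ a b c → (x :+ x′) :* a :+ ((y :+ y′) :* b :+ (z :+ z′) :* c) :=
      (x :* a :+ (y :* b :+ z :* c)) :+ (x′ :* a :+ (y′ :* b :+ z′ :* c))) refl x y z x′ y′ z′

  Emb-· : ∀ a k → Emb (a ·v k) ≈v (a ·v Emb k)
  Emb-· a (x , y , z) = law _ _ _ , law _ _ _ , law _ _ _
    where
    law : ∀ u v w → (a * x) * u + ((a * y) * v + (a * z) * w) ≈ a * (x * u + (y * v + z * w))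
    law = solve 7 (λ a x y z u v w → (a :* x) :* u :+ ((a :* y) :* v :+ (a :* z) :* w) :=
      a :* (x :* u :+ (y :* v :+ z :* w))) refl a x y z

  Emb-0 : Emb 0v ≈v 0v
  Emb-0 = ≈v.trans (Emb-cong (≈v.sym (·v-zeroˡ 0v))) (≈v.trans (Emb-· 0# 0v) (·v-zeroˡ _))

  Emb-≈0 : ∀ {k} → Emb k ≈v 0v → k ≈v 0v
  Emb-≈0 {x , y , z} eq = x≈0 , y≈0 , z≈0
    where
    [e₃] : KComb (e₃ ∷ []) (z ·v e₃)
    [e₃] = KComb-resp (+v-identityʳ _) (KComb-cons z (nil ≈v.refl))
    rest : ∀ {x u v} → x ≈ 0# → ((x ·v u) +v v) ≈v 0v → v ≈v 0v
    rest {x} {u} {v} x≈0 eq = ≈v.trans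
      (≈v.sym (≈v.trans (+v-cong (≈v.trans (·v-cong x≈0 ≈v.refl) (·v-zeroˡ u)) ≈v.refl)
        (+-identityˡ _ , +-identityˡ _ , +-identityˡ _)))
      eq
    x≈0 : x ≈ 0#
    x≈0 = independent-coefficient (proj₁ basis) (KComb-cons y [e₃]) eq
    y≈0 : y ≈ 0#
    y≈0 = independent-coefficient (proj₁ (proj₂ basis)) [e₃] (rest x≈0 eq)
    z≈0 : z ≈ 0#
    z≈0 = independent-coefficient (proj₁ (proj₂ (proj₂ basis))) (nil ≈v.refl)
      (≈v.trans (+v-identityʳ _) (rest y≈0 (rest x≈0 eq)))

  Emb-inj : ∀ {k l} → Emb k ≈v Emb l → k ≈v l
  Emb-inj {k} {l} eq = u-v≈0⇒u≈v (Emb-≈0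
    (≈v.trans (Emb-+ k _) (≈v.trans (+v-cong ≈v.refl (Emb-· _ l)) (u≈v⇒u-v≈0 eq))))

  -- An injection of the finite set V into itself is onto, so no coordinates need to be solved for.
  Emb-surj : ∀ v → ∃ λ k → Emb k ≈v v
  Emb-surj v = let (y , (k , _ , Emb-k≈y) , y≈v) = E.Enum-⊆⇒⊇
                     (Images.Enum-image ≈v.isEquivalence Emb Emb-cong (λ _ _ → Emb-inj) V-enum)
                     V-enum (λ _ _ → tt) v tt
               in k , ≈v.trans Emb-k≈y y≈v

  InF-0 : InF 0#
  InF-0 = pow-0 (ℕ.<⇒≤ 1<q)
    where
    pow-0 : ∀ {n} → 0 ℕ.< n → pow 0# n ≈ 0#
    pow-0 (ℕ.s≤s _) = zeroˡ _

  InF-1 : InF 1#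
  InF-1 = pow-1 q
    where
    pow-1 : ∀ n → pow 1# n ≈ 1#
    pow-1 zero = refl
    pow-1 (suc n) = trans (*-identityˡ _) (pow-1 n)

  -- A frame of the fixed subplane, written through `Emb` because `fixes` speaks of exactly these
  -- combinations of e₁, e₂, e₃.
  E₁ E₂ E₃ U : V
  E₁ = Emb (1# , 0# , 0#)
  E₂ = Emb (0# , 1# , 0#)
  E₃ = Emb (0# , 0# , 1#)
  U = Emb (1# , 1# , 1#)

  μ₁ μ₂ μ₃ μ : Carrier
  μ₁ = proj₁ (fixes _ _ _ InF-1 InF-0 InF-0)
  μ₂ = proj₁ (fixes _ _ _ InF-0 InF-1 InF-0)
  μ₃ = proj₁ (fixes _ _ _ InF-0 InF-0 InF-1)
  μ = proj₁ (fixes _ _ _ InF-1 InF-1 InF-1)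

  σ-≈ : ∀ {x y} → x ≈v y → σ x ≈v σ y
  σ-≈ = σ-cong _ _

  E-combination : ∀ x y z → ((x ·v E₁) +v ((y ·v E₂) +v (z ·v E₃))) ≈v Emb (x , y , z)
  E-combination x y z = ≈v.sym (≈v.trans (Emb-cong (law₁ x y z , law₂ x y z , law₃ x y z))
    (≈v.trans (Emb-+ _ _) (+v-cong (Emb-· x _) (≈v.trans (Emb-+ _ _) (+v-cong (Emb-· y _) (Emb-· z _))))))
    where
    law₁ : ∀ x y z → x ≈ x * 1# + (y * 0# + z * 0#)
    law₁ = solve 3 (λ x y z → x := x :* :1 :+ (y :* :0 :+ z :* :0)) refl
    law₂ : ∀ x y z → y ≈ x * 0# + (y * 1# + z * 0#)
    law₂ = solve 3 (λ x y z → y := x :* :0 :+ (y :* :1 :+ z :* :0)) refl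
    law₃ : ∀ x y z → z ≈ x * 0# + (y * 0# + z * 1#)
    law₃ = solve 3 (λ x y z → z := x :* :0 :+ (y :* :0 :+ z :* :1)) refl

  private
    h₁ h₂ h₃ : Carrier → Carrier
    h₁ x = proj₁ (σ-Kline x E₁)
    h₂ x = proj₁ (σ-Kline x E₂)
    h₃ x = proj₁ (σ-Kline x E₃)

    σ-Emb′ : ∀ x y z → σ (Emb (x , y , z)) ≈v Emb (h₁ x * μ₁ , h₂ y * μ₂ , h₃ z * μ₃)
    σ-Emb′ x y z = begin
      σ (Emb (x , y , z))
        ≈⟨ σ-≈ (≈v.sym (E-combination x y z)) ⟩
      σ ((x ·v E₁) +v ((y ·v E₂) +v (z ·v E₃)))
        ≈⟨ ≈v.trans (σ-add _ _) (+v-cong ≈v.refl (σ-add _ _)) ⟩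
      σ (x ·v E₁) +v (σ (y ·v E₂) +v σ (z ·v E₃))
        ≈⟨ +v-cong (scaled (proj₂ (fixes _ _ _ InF-1 InF-0 InF-0)))
             (+v-cong (scaled (proj₂ (fixes _ _ _ InF-0 InF-1 InF-0))) (scaled (proj₂ (fixes _ _ _ InF-0 InF-0 InF-1)))) ⟩
      ((h₁ x * μ₁) ·v E₁) +v (((h₂ y * μ₂) ·v E₂) +v ((h₃ z * μ₃) ·v E₃))
        ≈⟨ E-combination _ _ _ ⟩
      Emb (h₁ x * μ₁ , h₂ y * μ₂ , h₃ z * μ₃) ∎
      where
      open SetoidReasoning V-setoid
      scaled : ∀ {x v m} → σ v ≈v (m ·v v) → σ (x ·v v) ≈v ((proj₁ (σ-Kline x v) * m) ·v v)
      scaled {x} {v} {m} eq = ≈v.trans (proj₂ (σ-Kline x v)) (≈v.trans (·v-congˡ eq) (·v-assoc _ m v))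

    σ-U : ∀ k → σ (k ·v U) ≈v Emb ((proj₁ (σ-Kline k U) * μ) ·v (1# , 1# , 1#))
    σ-U k = ≈v.trans (proj₂ (σ-Kline k U)) (≈v.trans (·v-congˡ (proj₂ (fixes _ _ _ InF-1 InF-1 InF-1)))
      (≈v.trans (·v-assoc _ _ U) (≈v.sym (Emb-· _ _))))

    -- The unit point U is fixed as well, so the image of k · U is a multiple of U; this forces the
    -- three coordinate functions to coincide.
    diagonal : ∀ k → let k′ = proj₁ (σ-Kline k U) * μ in
      (h₁ k * μ₁ ≈ k′) × (h₂ k * μ₂ ≈ k′) × (h₃ k * μ₃ ≈ k′)
    diagonal k = let (a , b , c) = Emb-inj (≈v.trans (≈v.sym (σ-Emb′ k k k))
                       (≈v.trans (σ-≈ (≈v.trans (Emb-cong (≈k , ≈k , ≈k)) (Emb-· k _))) (σ-U k)))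
                 in trans a (*-identityʳ _) , trans b (*-identityʳ _) , trans c (*-identityʳ _)
      where
      ≈k : k ≈ k * 1#
      ≈k = sym (*-identityʳ k)

  -- The companion automorphism of σ: the points of the subplane force σ (k · U) to be f k · σ U.
  f : Carrier → Carrier
  f k = proj₁ (σ-Kline k U)

  g : Carrier → Carrier
  g x = μ * f x

  σ-Emb : ∀ x y z → σ (Emb (x , y , z)) ≈v Emb (g x , g y , g z)
  σ-Emb x y z = ≈v.trans (σ-Emb′ x y z) (Emb-cong
    ( trans (proj₁ (diagonal x)) (*-comm _ _)
    , trans (proj₁ (proj₂ (diagonal y))) (*-comm _ _)
    , trans (proj₂ (proj₂ (diagonal z))) (*-comm _ _)))

  σ-0 : σ 0v ≈v 0v
  σ-0 = ≈v.trans (σ-≈ (≈v.sym (·v-zeroˡ 0v))) (≈v.trans (σ-Flin 0# 0v InF-0) (·v-zeroˡ _))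

  μ≉0 : ¬ μ ≈ 0#
  μ≉0 μ≈0 = 0≉1 (sym (proj₁ (Emb-≈0 {1# , 1# , 1#} (σ-inj _ _ (≈v.trans
    (proj₂ (fixes _ _ _ InF-1 InF-1 InF-1))
    (≈v.trans (·v-cong μ≈0 ≈v.refl) (≈v.trans (·v-zeroˡ U) (≈v.sym σ-0))))))))

  private
    μ-cancel : ∀ {x y} → μ * x ≈ μ * y → x ≈ y
    μ-cancel = *-cancel-≉0 μ≉0

  f-cong : ∀ {x y} → x ≈ y → f x ≈ f y
  f-cong {x} {y} x≈y = μ-cancel (proj₁ (Emb-inj (≈v.trans (≈v.sym (σ-Emb x 0# 0#))
    (≈v.trans (σ-≈ (Emb-cong (x≈y , refl , refl))) (σ-Emb y 0# 0#)))))

  f-+ : ∀ x y → f (x + y) ≈ f x + f y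
  f-+ x y = μ-cancel (trans
    (proj₁ (Emb-inj (≈v.trans (≈v.sym (σ-Emb _ _ _))
      (≈v.trans (σ-≈ (Emb-+ (x , x , x) (y , y , y)))
        (≈v.trans (σ-add _ _) (≈v.trans (+v-cong (σ-Emb x x x) (σ-Emb y y y)) (≈v.sym (Emb-+ _ _))))))))
    (sym (distribˡ μ _ _)))

  g-1 : g 1# ≈ μ
  g-1 = trans (proj₁ (Emb-inj (≈v.trans (≈v.sym (σ-Emb 1# 1# 1#))
    (≈v.trans (proj₂ (fixes _ _ _ InF-1 InF-1 InF-1)) (≈v.sym (Emb-· μ _)))))) (*-identityʳ μ)

  f-1 : f 1# ≈ 1#
  f-1 = μ-cancel (trans g-1 (sym (*-identityʳ μ)))

  -- The image of x · (y, 1, 1) is a multiple x′ of the image of (y, 1, 1): the second coordinate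
  -- shows x′ = f x, and the first is then multiplicativity.
  f-* : ∀ x y → f (x * y) ≈ f x * f y
  f-* x y = μ-cancel (begin
    μ * f (x * y)        ≈⟨ proj₁ eqs ⟩
    x′ * (μ * f y)       ≈⟨ solve 3 (λ a b c → a :* (b :* c) := b :* (a :* c)) refl x′ μ (f y) ⟩
    μ * (x′ * f y)       ≈⟨ *-congˡ (*-congʳ fx≈x′) ⟨
    μ * (f x * f y) ∎)
    where
    open SetoidReasoning setoid
    v : V
    v = Emb (y , 1# , 1#)
    x′ : Carrier
    x′ = proj₁ (σ-Kline x v)
    eqs : (g (x * y) , g (x * 1#) , g (x * 1#)) ≈v (x′ ·v (g y , g 1# , g 1#))
    eqs = Emb-inj (≈v.trans (≈v.sym (σ-Emb _ _ _)) (≈v.trans (σ-≈ (Emb-· x _))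
      (≈v.trans (proj₂ (σ-Kline x v)) (≈v.trans (·v-congˡ (σ-Emb y 1# 1#)) (≈v.sym (Emb-· x′ _))))))
    fx≈x′ : f x ≈ x′
    fx≈x′ = μ-cancel (begin
      μ * f x          ≈⟨ *-congˡ (f-cong (*-identityʳ x)) ⟨
      g (x * 1#)       ≈⟨ proj₁ (proj₂ eqs) ⟩
      x′ * g 1#        ≈⟨ *-congˡ g-1 ⟩
      x′ * μ           ≈⟨ *-comm x′ μ ⟩
      μ * x′ ∎)

  g³ : ∀ x → g (g (g x)) ≈ proj₁ σ³-id * x
  g³ x = proj₁ (Emb-inj (≈v.trans (≈v.sym (σ-Emb (g (g x)) (g (g x)) (g (g x))))
    (≈v.trans (σ-≈ (≈v.trans (≈v.sym (σ-Emb (g x) (g x) (g x))) (σ-≈ (≈v.sym (σ-Emb x x x)))))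
      (≈v.trans (proj₂ (proj₂ (proj₂ σ³-id)) (Emb (x , x , x))) (≈v.sym (Emb-· _ _))))))

  -- Multiplicativity turns g³ x into ν f³ x, where ν is the product of the conjugates of μ. Taking
  -- x = 1 gives ν = c, which cancels against g³ x = c x.
  f³ : ∀ x → f (f (f x)) ≈ x
  f³ x = *-cancel-≉0 (proj₁ (proj₂ (proj₂ σ³-id))) (trans (trans (*-congʳ (sym norm)) (sym (g³-norm x))) (g³ x))
    where
    ν : Carrier
    ν = μ * (f μ * f (f μ))
    g³-norm : ∀ x → g (g (g x)) ≈ ν * f (f (f x))
    g³-norm x = trans
      (*-congˡ (trans (f-* _ _) (*-congˡ (trans (f-cong (f-* _ _)) (f-* _ _)))))
      (solve 4 (λ a b c d → a :* (b :* (c :* d)) := (a :* (b :* c)) :* d) refl μ (f μ) (f (f μ)) (f (f (f x))))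
    norm : ν ≈ proj₁ σ³-id
    norm = trans (sym (trans (*-congˡ (trans (f-cong (trans (f-cong f-1) f-1)) f-1)) (*-identityʳ ν)))
      (trans (sym (g³-norm 1#)) (trans (g³ 1#) (*-identityʳ _)))

  -- If f were the identity, σ would be multiplication by μ and φ would fix every point.
  f-moved : ∃ λ θ → ¬ f θ ≈ θ
  f-moved = let (i , moved) = ¬∀⟶∃¬ _ (λ i → f (to K-enum i) ≈ to K-enum i)
                                (λ i → f (to K-enum i) ≟ to K-enum i) not-all
            in to K-enum i , moved
    where
    not-all : ¬ (∀ i → f (to K-enum i) ≈ to K-enum i)
    not-all all = proj₂ (proj₂ φ-nonid) (μ ,
      ≈v.trans (σ-≈ (≈v.sym Emb≈v)) (≈v.trans (σ-Emb _ _ _)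
        (≈v.trans (Emb-cong (*-congˡ (fixed _) , *-congˡ (fixed _) , *-congˡ (fixed _)))
          (≈v.trans (Emb-· μ _) (·v-congˡ Emb≈v)))))
      where
      Emb≈v : Emb (proj₁ (Emb-surj (proj₁ φ-nonid))) ≈v proj₁ φ-nonid
      Emb≈v = proj₂ (Emb-surj (proj₁ φ-nonid))
      fixed : ∀ x → f x ≈ x
      fixed x = let (i , eq) = index K-enum x tt in trans (f-cong (sym eq)) (trans (all i) eq)

  f-isAut : IsOrder3Automorphism R f
  f-isAut = record
    { f-cong = f-cong ; f-+ = f-+ ; f-* = f-* ; f-1 = f-1 ; f³ = f³ ; moved = f-moved }

  open FixedField R isField q K-enum f f-isAut

  -- Computing σ (a · U) by F_q-linearity and through g gives a g 1 = g a. With `Fix⇒pow` this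
  -- identifies `InF` with the fixed field, and the subfield laws carry over.
  InF⇒Fix : ∀ {a} → InF a → Fix a
  InF⇒Fix {a} Fa = μ-cancel (begin
    μ * f a            ≈⟨ *-congˡ (f-cong (*-identityʳ a)) ⟨
    g (a * 1#)         ≈⟨ proj₁ (Emb-inj {g (a * 1#) , g (a * 1#) , g (a * 1#)} {a ·v (g 1# , g 1# , g 1#)}
                            (≈v.trans (≈v.sym (σ-Emb _ _ _)) (≈v.trans (σ-≈ (Emb-· a _))
                              (≈v.trans (σ-Flin a _ Fa) (≈v.trans (·v-congˡ (σ-Emb _ _ _)) (≈v.sym (Emb-· a _))))))) ⟩
    a * g 1#           ≈⟨ *-congˡ g-1 ⟩
    a * μ              ≈⟨ *-comm a μ ⟩
    μ * a ∎)
    where open SetoidReasoning setoid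

  isSubfield : IsSubfield R InF
  isSubfield = record
    { F-resp = λ x≈y Fx → Fix⇒pow (Fix-resp x≈y (InF⇒Fix Fx))
    ; F-0 = InF-0
    ; F-1 = InF-1
    ; F-+ = λ Fx Fy → Fix⇒pow (Fix-+ (InF⇒Fix Fx) (InF⇒Fix Fy))
    ; F-* = λ Fx Fy → Fix⇒pow (Fix-* (InF⇒Fix Fx) (InF⇒Fix Fy))
    ; F-neg = λ Fx → Fix⇒pow (Fix-neg (InF⇒Fix Fx))
    ; F-inv = λ {x} {y} xy≈1 Fx → Fix⇒pow (Fix-/
        (λ x≈0 → 0≉1 (trans (sym (zeroˡ y)) (trans (*-congʳ (sym x≈0)) xy≈1)))
        (InF⇒Fix Fx) (Fix-resp (sym xy≈1) f-1)) }

  F-enum : Enum _≈_ InF q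
  F-enum = K.Enum-cong (λ _ → Fix⇒pow) (λ _ → InF⇒Fix) Fix-enum

  open LinearAlgebra R isField q K-enum isSubfield F-enum hiding (_≟_; _≟v_; V-enum; module K; module E)
  open FLinearMap R isField q K-enum isSubfield F-enum 1<q σ e₁ e₂ e₃ setting hiding (σ-≈; σ-0)
  open IsFSubspace

  -- A basis of the kernel of the cofactor in K³

  FComb-Emb : ∀ {ks k} → FComb ks k → FComb (map Emb ks) (Emb k)
  FComb-Emb (nil k≈0) = nil (≈v.trans (Emb-cong k≈0) Emb-0)
  FComb-Emb (cons {v} a y Fa comb k≈) = cons a (Emb y) Fa (FComb-Emb comb)
    (≈v.trans (Emb-cong k≈) (≈v.trans (Emb-+ _ y) (+v-cong (Emb-· a v) ≈v.refl)))

  FComb-Emb⁻ : ∀ {ks x} → FComb (map Emb ks) x → ∃ λ k → FComb ks k × Emb k ≈v x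
  FComb-Emb⁻ {[]} (nil x≈0) = 0v , nil ≈v.refl , ≈v.trans Emb-0 (≈v.sym x≈0)
  FComb-Emb⁻ {v ∷ ks} (cons a y Fa comb x≈) with FComb-Emb⁻ {ks} comb
  ... | k , comb′ , eq = (a ·v v) +v k , cons a k Fa comb′ ≈v.refl ,
    ≈v.trans (Emb-+ _ k) (≈v.trans (+v-cong (Emb-· a v) eq) (≈v.sym x≈))

  FIndep-Emb : ∀ ks → FIndep ks → FIndep (map Emb ks)
  FIndep-Emb [] _ = tt
  FIndep-Emb (v ∷ ks) (v∉ , indep) =
    (λ comb → let (k , comb′ , eq) = FComb-Emb⁻ comb in v∉ (FComb-resp (Emb-inj eq) comb′)) , FIndep-Emb ks indep

  -- σ acts by the same g on each coordinate, so the kernel is three copies of the two-dimensional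
  -- kernel spanned by s and t.
  kernel-basis : ∀ {ℓ} → IsEigenvalue ℓ → KernelBasis ℓ
  kernel-basis {ℓ} eig = map Emb ks , ≡.refl , FIndep-Emb ks independent , images , spanning
    where
    open IsEigenvalue eig
    open TwistedKernel R isField q K-enum f f-isAut μ ℓ hiding (g) renaming (T to t-map)

    ℓ≉0 : ¬ ℓ ≈ 0#
    ℓ≉0 ℓ≈0 = c≉0 (trans (sym ℓ³≈c) (trans (*-congʳ ℓ≈0) (zeroˡ _)))

    g³≈ℓ³ : ∀ x → g (g (g x)) ≈ (ℓ * (ℓ * ℓ)) * x
    g³≈ℓ³ x = trans (g³ x) (*-congʳ (sym ℓ³≈c))

    open Basis μ≉0 ℓ≉0 (InF⇒Fix Fℓ) g³≈ℓ³

    ks : List V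
    ks = (s , 0# , 0#) ∷ (t , 0# , 0#) ∷ (0# , s , 0#) ∷ (0# , t , 0#) ∷ (0# , 0# , s) ∷ (0# , 0# , t) ∷ []

    -- Zero sets of F_q-linear functionals are the test subspaces: a functional that kills the tail
    -- of a list but not its head keeps the head out of the span of the tail.
    vanishing : (L : V → Carrier) → (∀ {u v} → u ≈v v → L u ≈ L v) → L 0v ≈ 0# →
      (∀ {a} u v → InF a → L ((a ·v u) +v v) ≈ a * L u + L v) → IsFSubspace (λ v → L v ≈ 0#)
    vanishing L L-cong L-0 L-linear = record
      { ∈-resp = λ u≈v Lu → trans (L-cong (≈v.sym u≈v)) Lu
      ; ∈-0 = L-0
      ; ∈-+ = λ {u} {v} Lu Lv → trans (L-cong (+v-cong (≈v.sym (·v-identityˡ u)) ≈v.refl)) (L-combination u v InF-1 Lu Lv)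
      ; ∈-· = λ {a} {v} Fa Lv → trans (L-cong (≈v.sym (+v-identityʳ _))) (L-combination v 0v Fa Lv L-0) }
      where
      L-combination : ∀ {a} u v → InF a → L u ≈ 0# → L v ≈ 0# → L ((a ·v u) +v v) ≈ 0#
      L-combination {a} u v Fa Lu Lv = trans (L-linear u v Fa)
        (trans (+-cong (trans (*-congˡ Lu) (zeroʳ a)) Lv) (+-identityˡ 0#))

    pr₁ pr₂ pr₃ : V → Carrier
    pr₁ = proj₁
    pr₂ = proj₁ ∘ proj₂
    pr₃ = proj₂ ∘ proj₂

    W-t∘ : (p : V → Carrier) → (∀ {u v} → u ≈v v → p u ≈ p v) → p 0v ≈ 0# →
      (∀ a u v → p ((a ·v u) +v v) ≈ a * p u + p v) → IsFSubspace (λ v → W (p v) t ≈ 0#)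
    W-t∘ p p-cong p-0 p-linear = vanishing (λ v → W (p v) t) (λ u≈v → W-congˡ t (p-cong u≈v))
      (trans (W-congˡ t p-0) (W-0 t))
      (λ {a} u v Fa → trans (W-congˡ t (p-linear a u v)) (W-linear (InF⇒Fix Fa) (p u) (p v) t))

    W-tt : W t t ≈ 0#
    W-tt = -‿inverseʳ _

    -- In each coordinate W(·, t) kills t but not s, which separates s; the coordinate function
    -- itself then separates t from what follows.
    independent : FIndep ks
    independent =
      (λ comb → W-st≉0 (FComb-least (W-t∘ pr₁ proj₁ refl (λ _ _ _ → refl))
        (W-tt ∷ W-0 t ∷ W-0 t ∷ W-0 t ∷ W-0 t ∷ []) _ comb)) ,
      (λ comb → t≉0 (FComb-least (vanishing pr₁ proj₁ refl (λ _ _ _ → refl))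
        (refl ∷ refl ∷ refl ∷ refl ∷ []) _ comb)) ,
      (λ comb → W-st≉0 (FComb-least (W-t∘ pr₂ (proj₁ ∘ proj₂) refl (λ _ _ _ → refl))
        (W-tt ∷ W-0 t ∷ W-0 t ∷ []) _ comb)) ,
      (λ comb → t≉0 (FComb-least (vanishing pr₂ (proj₁ ∘ proj₂) refl (λ _ _ _ → refl))
        (refl ∷ refl ∷ []) _ comb)) ,
      (λ comb → W-st≉0 (FComb-least (W-t∘ pr₃ (proj₂ ∘ proj₂) refl (λ _ _ _ → refl))
        (W-tt ∷ []) _ comb)) ,
      (λ { (nil (_ , _ , t≈0)) → t≉0 t≈0 }) , tt

    n : Carrier → Carrier
    n x = g x - ℓ * x

    n-0 : n 0# ≈ 0#
    n-0 = trans (+-cong (trans (*-congˡ f-0) (zeroʳ μ)) (-‿cong (zeroʳ ℓ))) (-‿inverseʳ 0#)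

    N-Emb : ∀ x y z → N ℓ (Emb (x , y , z)) ≈v Emb (n x , n y , n z)
    N-Emb x y z = ≈v.trans (-v-cong (σ-Emb x y z) (≈v.sym (Emb-· ℓ _)))
      (≈v.trans (+v-cong ≈v.refl (≈v.sym (Emb-· _ _))) (≈v.trans (≈v.sym (Emb-+ _ _))
        (Emb-cong (law _ _ , law _ _ , law _ _))))
      where
      law : ∀ x y → x + (- 1#) * y ≈ x - y
      law = solve 2 (λ x y → x :+ (:- :1) :* y := x :- y) refl

    images : All (λ b → ∃ λ x → N ℓ x ≈v b) (map Emb ks)
    images =
      -- The inferred preimages have η₁ or η₂ in the coordinate of s or t, and 0 in the other two.
      (_ , image (refl , n-0 , n-0)) ∷ (_ , image (refl , n-0 , n-0)) ∷
      (_ , image (n-0 , refl , n-0)) ∷ (_ , image (n-0 , refl , n-0)) ∷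
      (_ , image (n-0 , n-0 , refl)) ∷ (_ , image (n-0 , n-0 , refl)) ∷ []
      where
      image : ∀ {x y z k} → (n x , n y , n z) ≈v k → N ℓ (Emb (x , y , z)) ≈v Emb k
      image eq = ≈v.trans (N-Emb _ _ _) (Emb-cong eq)

    T-Emb : ∀ x y z → T ℓ (Emb (x , y , z)) ≈v Emb (t-map x , t-map y , t-map z)
    T-Emb x y z = ≈v.trans
      (+v-cong (≈v.trans (σ-≈ (σ-Emb x y z)) (σ-Emb _ _ _))
        (+v-cong (≈v.trans (·v-congˡ (σ-Emb x y z)) (≈v.sym (Emb-· ℓ _))) (≈v.sym (Emb-· (ℓ * ℓ) _))))
      (≈v.trans (+v-cong ≈v.refl (≈v.sym (Emb-+ _ _))) (≈v.sym (Emb-+ _ _)))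

    kernel-combination : ∀ {x y z} → t-map x ≈ 0# → t-map y ≈ 0# → t-map z ≈ 0# → FComb ks (x , y , z)
    kernel-combination {x} {y} {z} Tx Ty Tz =
      let (a₁ , b₁ , Fa₁ , Fb₁ , x≈) = kernel-coordinates x Tx
          (a₂ , b₂ , Fa₂ , Fb₂ , y≈) = kernel-coordinates y Ty
          (a₃ , b₃ , Fa₃ , Fb₃ , z≈) = kernel-coordinates z Tz
      in cons a₁ _ (Fix⇒pow Fa₁) (cons b₁ _ (Fix⇒pow Fb₁) (cons a₂ _ (Fix⇒pow Fa₂) (cons b₂ _ (Fix⇒pow Fb₂)
           (cons a₃ _ (Fix⇒pow Fa₃) (cons b₃ 0v (Fix⇒pow Fb₃) (nil ≈v.refl) ≈v.refl) ≈v.refl) ≈v.refl) ≈v.refl) ≈v.refl)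
           (trans x≈ (law₁ a₁ b₁ a₂ b₂ a₃ b₃) , trans y≈ (law₂ a₁ b₁ a₂ b₂ a₃ b₃) , trans z≈ (law₃ a₁ b₁ a₂ b₂ a₃ b₃))
      where
      law₁ : ∀ a₁ b₁ a₂ b₂ a₃ b₃ → a₁ * s + b₁ * t ≈ a₁ * s + (b₁ * t + (a₂ * 0# + (b₂ * 0# + (a₃ * 0# + (b₃ * 0# + 0#)))))
      law₁ = solve 8 (λ s t a₁ b₁ a₂ b₂ a₃ b₃ → a₁ :* s :+ b₁ :* t :=
        a₁ :* s :+ (b₁ :* t :+ (a₂ :* :0 :+ (b₂ :* :0 :+ (a₃ :* :0 :+ (b₃ :* :0 :+ :0)))))) refl s t
      law₂ : ∀ a₁ b₁ a₂ b₂ a₃ b₃ → a₂ * s + b₂ * t ≈ a₁ * 0# + (b₁ * 0# + (a₂ * s + (b₂ * t + (a₃ * 0# + (b₃ * 0# + 0#)))))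
      law₂ = solve 8 (λ s t a₁ b₁ a₂ b₂ a₃ b₃ → a₂ :* s :+ b₂ :* t :=
        a₁ :* :0 :+ (b₁ :* :0 :+ (a₂ :* s :+ (b₂ :* t :+ (a₃ :* :0 :+ (b₃ :* :0 :+ :0)))))) refl s t
      law₃ : ∀ a₁ b₁ a₂ b₂ a₃ b₃ → a₃ * s + b₃ * t ≈ a₁ * 0# + (b₁ * 0# + (a₂ * 0# + (b₂ * 0# + (a₃ * s + (b₃ * t + 0#)))))
      law₃ = solve 8 (λ s t a₁ b₁ a₂ b₂ a₃ b₃ → a₃ :* s :+ b₃ :* t :=
        a₁ :* :0 :+ (b₁ :* :0 :+ (a₂ :* :0 :+ (b₂ :* :0 :+ (a₃ :* s :+ (b₃ :* t :+ :0)))))) refl s t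

    spanning : Kernel ℓ ⊆ FComb (map Emb ks)
    spanning v v∈Ker =
      let ((x , y , z) , Emb≈v) = Emb-surj v
          (Tx , Ty , Tz) = Emb-≈0 (≈v.trans (≈v.sym (T-Emb x y z)) (≈v.trans (T-cong refl Emb≈v) v∈Ker))
      in FComb-resp Emb≈v (FComb-Emb (kernel-combination Tx Ty Tz))

  open WithKernelBasis kernel-basis public

  I-dot : ∀ {w} → IDotPoint w → IsDotPoint w
  I-dot ((nz , _) , not-fixed , _ , _ , coll) = record
    { nonzero = nz ; not-fixed = not-fixed ; collinear = coll }

  -- A point of type II already moves in PG(2,q³), so σ w is not even a K-multiple of w.
  II-dot : ∀ {w} → IIDotPoint w → IsDotPoint w
  II-dot ((nz , not-fixed , _) , coll) = record
    { nonzero = nz ; not-fixed = λ (a , _ , eq) → not-fixed (a , eq) ; collinear = coll }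

HasSize⇒Enum : ∀ R {n} → HasSize R n → Enum (CommutativeRing._≈_ R) (λ _ → ⊤) n
HasSize⇒Enum R (enumerate , inj , surj) = record
  { to = enumerate ; to-inj = inj ; to-in = λ _ → tt ; index = λ x _ → surj x }

theorem10 : (R : CommutativeRing 0ℓ 0ℓ) → IsField R →
  (q : ℕ) → IsPrimePower q → 2 < q → HasSize R (q ^ 3) →
  let open Geometry R q in
  (σ : V → V) (e₁ e₂ e₃ : V) → Setting σ e₁ e₂ e₃ →
  let open WithMaps σ e₁ e₂ e₃ in
  ((∀ w → IDotPoint w → UniqueHwise (PointSub w)) ×
   (∀ w → IIDotPoint w → UniqueHwise (PointSub w))) ×
  ((∀ L → FixedILine L → UniqueHwise L) ×
   (∀ L → FixedIILine L → UniqueHwise L))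
theorem10 R isField q _ 2<q size σ e₁ e₂ e₃ setting =
  ((λ w dot → point-uniqueHwise (I-dot dot)) , (λ w dot → point-uniqueHwise (II-dot dot))) ,
  ((λ { L (space , fixed , w , w∈L , dot) → line-uniqueHwise (I-dot dot) L space fixed w∈L }) ,
   (λ { L (space , fixed , w , w∈L , dot) → line-uniqueHwise (II-dot dot) L space fixed w∈L }))
  where
  open SemilinearCoordinates R isField q (ℕ.<⇒≤ 2<q) (HasSize⇒Enum R size) σ e₁ e₂ e₃ setting
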